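{- The complete bipartite graph $K_{3,3}$ is not isomorphic to the rook equivalence graph $G(B)$ of any Ferrers board $B$.
   Context: A Ferrers board is given by a weakly increasing sequence of non-negative integers $B=(b_1,\ldots,b_n)$ of column heights; it is the set of unit cells in the first quadrant lying in column $i$ and rows $1,\ldots,b_i$. Prepending columns of height $0$ on the left does not change the board, and boards are compared using the same number of columns by such padding. A placement of $k$ rooks on $B$ is a set of $k$ cells of $B$ no two in the same row or column; $r_k(B)$ is the number of such placements. Two boards are rook equivalent if they have equal $r_k$ for all $k\ge 0$. The rook equivalence graph $G(B)$ has as vertices all Ferrers boards rook equivalent to $B$, and $\{B_1,B_2\}$ is an edge iff, written with the same number of columns, $B_1$ and $B_2$ differ in exactly two columns $i$ and $j$, where $B_1$ has $k$ more cells than $B_2$ in column $i$ and $k$ fewer cells than $B_2$ in column $j$, for some $k>0$. -}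

module Defs where

open import Data.Empty using (⊥)
open import Data.Fin as Fin using (Fin)
open import Data.List using (List; []; _∷_; _++_; [_]; map; filter; length; replicate; applyUpTo)
open import Data.List.Properties using (length-++; length-replicate)
open import Data.List.Relation.Unary.AllPairs using (AllPairs; allPairs?)
open import Data.List.Relation.Unary.Sorted.TotalOrder using (Sorted)
open import Data.Nat using (ℕ; zero; suc; _+_; _<_; _≟_)
open import Data.Nat.Properties using (≤-totalOrder; +-comm; +-suc; +-cancelʳ-≡; m≢1+m+n)
open import Data.Product using (Σ; ∃; ∃₂; _×_; _,_; proj₁; proj₂)
open import Data.Sum using (_⊎_; inj₁; inj₂)
open import Data.Unit using (⊤; tt)
open import Data.Vec as Vec using (Vec; lookup; toList)
open import Data.Vec.Properties using (length-toList; toList-injective; cast-is-id)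
open import Function.Bundles using (Inverse; _⇔_)
open import Level using (0ℓ)
open import Relation.Binary using (Rel; Setoid; Symmetric; IsEquivalence)
import Relation.Binary.Construct.On as On
open import Relation.Binary.PropositionalEquality
  using (_≡_; _≢_; refl; sym; trans; cong; module ≡-Reasoning)
import Relation.Binary.PropositionalEquality as ≡
open import Relation.Nullary using (¬_; ¬?; _×-dec_)
open import Relation.Unary using (Decidable)

-- Vertices form a setoid, so that boards can be identified up to padding.
record SimpleGraph : Set₁ where
  field
    vertices   : Setoid 0ℓ 0ℓ
  open Setoid vertices public using (_≈_) renaming (Carrier to Vertex)
  field
    Adjacent   : Rel Vertex 0ℓ
    adj-resp   : ∀ {u u′ v v′} → u ≈ u′ → v ≈ v′ → Adjacent u v → Adjacent u′ v′
    adj-sym    : Symmetric Adjacent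
    adj-irrefl : ∀ {u v} → u ≈ v → ¬ Adjacent u v

record _≅_ (G H : SimpleGraph) : Set where
  private
    module G = SimpleGraph G
    module H = SimpleGraph H
  field
    bijection : Inverse G.vertices H.vertices
  open Inverse bijection public using (to; from)
  field
    adjacent⇔ : ∀ u v → G.Adjacent u v ⇔ H.Adjacent (to u) (to v)

OppositeSides : ∀ {m n} → Rel (Fin m ⊎ Fin n) 0ℓ
OppositeSides (inj₁ _) (inj₁ _) = ⊥
OppositeSides (inj₁ _) (inj₂ _) = ⊤
OppositeSides (inj₂ _) (inj₁ _) = ⊤
OppositeSides (inj₂ _) (inj₂ _) = ⊥

completeBipartite : ℕ → ℕ → SimpleGraph
completeBipartite m n = record
  { vertices   = ≡.setoid (Fin m ⊎ Fin n)
  ; Adjacent   = OppositeSides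
  ; adj-resp   = λ { refl refl a → a }
  ; adj-sym    = λ {u} {v} → symmetric u v
  ; adj-irrefl = λ { {u} refl → irreflexive u }
  }
  where
  symmetric : ∀ (u v : Fin m ⊎ Fin n) → OppositeSides u v → OppositeSides v u
  symmetric (inj₁ _) (inj₂ _) _ = tt
  symmetric (inj₂ _) (inj₁ _) _ = tt

  irreflexive : ∀ (u : Fin m ⊎ Fin n) → ¬ OppositeSides u u
  irreflexive (inj₁ _) ()
  irreflexive (inj₂ _) ()

record Board : Set where
  constructor board
  field
    columns    : List ℕ
    increasing : Sorted ≤-totalOrder columns

open Board public

pad : ℕ → List ℕ → List ℕ
pad m bs = replicate m 0 ++ bs

infix 4 _≈ᵇ_

_≈ᵇ_ : Rel Board 0ℓ
A ≈ᵇ B = ∃₂ λ m n → pad m (columns A) ≡ pad n (columns B)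

pad-+ : ∀ m n bs → pad m (pad n bs) ≡ pad (m + n) bs
pad-+ zero    n bs = refl
pad-+ (suc m) n bs = cong (0 ∷_) (pad-+ m n bs)

pad-comm : ∀ m n bs → pad m (pad n bs) ≡ pad n (pad m bs)
pad-comm m n bs = begin
  pad m (pad n bs)  ≡⟨ pad-+ m n bs ⟩
  pad (m + n) bs    ≡⟨ cong (λ k → pad k bs) (+-comm m n) ⟩
  pad (n + m) bs    ≡⟨ pad-+ n m bs ⟨
  pad n (pad m bs)  ∎
  where open ≡-Reasoning

≈ᵇ-isEquivalence : IsEquivalence _≈ᵇ_
≈ᵇ-isEquivalence = record
  { refl  = 0 , 0 , refl
  ; sym   = λ { (m , n , eq) → n , m , sym eq }
  ; trans = λ {A} {B} {C} → λ { (m , n , A≈B) (p , q , B≈C) → p + m , n + q , (begin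
      pad (p + m) (columns A)    ≡⟨ pad-+ p m (columns A) ⟨
      pad p (pad m (columns A))  ≡⟨ cong (pad p) A≈B ⟩
      pad p (pad n (columns B))  ≡⟨ pad-comm p n (columns B) ⟩
      pad n (pad p (columns B))  ≡⟨ cong (pad n) B≈C ⟩
      pad n (pad q (columns C))  ≡⟨ pad-+ n q (columns C) ⟩
      pad (n + q) (columns C)    ∎) }
  }
  where open ≡-Reasoning

boardSetoid : Setoid 0ℓ 0ℓ
boardSetoid = record { isEquivalence = ≈ᵇ-isEquivalence }

-- A cell is a pair (column , row), both counted from 1.
Cell : Set
Cell = ℕ × ℕ

cellsFrom : ℕ → List ℕ → List Cell
cellsFrom i []       = []
cellsFrom i (b ∷ bs) = applyUpTo (λ r → i , suc r) b ++ cellsFrom (suc i) bs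

cells : Board → List Cell
cells B = cellsFrom 1 (columns B)

-- All sublists of length k.  As `cells B` has no repetitions, each k-element
-- set of cells of B occurs exactly once in `combinations k (cells B)`.
combinations : {A : Set} → ℕ → List A → List (List A)
combinations zero    _        = [ [] ]
combinations (suc k) []       = []
combinations (suc k) (x ∷ xs) = map (x ∷_) (combinations k xs) ++ combinations (suc k) xs

NonAttacking : List Cell → Set
NonAttacking = AllPairs λ c d → proj₁ c ≢ proj₁ d × proj₂ c ≢ proj₂ d

nonAttacking? : Decidable NonAttacking
nonAttacking? = allPairs? λ c d →
  ¬? (proj₁ c ≟ proj₁ d) ×-dec ¬? (proj₂ c ≟ proj₂ d)

placements : ℕ → Board → List (List Cell)
placements k B = filter nonAttacking? (combinations k (cells B))

rookNumber : ℕ → Board → ℕ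
rookNumber k B = length (placements k B)

RookEquivalent : Rel Board 0ℓ
RookEquivalent A B = ∀ k → rookNumber k A ≡ rookNumber k B

WrittenAs : ∀ {n} → Board → Vec ℕ n → Set
WrittenAs B v = ∃ λ m → toList v ≡ pad m (columns B)

DifferInTwoColumns : ∀ {n} → Rel (Vec ℕ n) 0ℓ
DifferInTwoColumns {n} v w =
  Σ (Fin n) λ i → Σ (Fin n) λ j → ∃ λ k →
    i ≢ j × 0 < k ×
    lookup v i ≡ lookup w i + k ×
    lookup w j ≡ lookup v j + k ×
    (∀ l → l ≢ i → l ≢ j → lookup v l ≡ lookup w l)

BoardAdjacent : Rel Board 0ℓ
BoardAdjacent A B = ∃ λ n → ∃₂ λ (v w : Vec ℕ n) →
  WrittenAs A v × WrittenAs B w × DifferInTwoColumns v w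

padᵛ : ∀ {n} m → Vec ℕ n → Vec ℕ (m + n)
padᵛ m v = Vec.replicate m 0 Vec.++ v

toList-padᵛ : ∀ {n} m (v : Vec ℕ n) → toList (padᵛ m v) ≡ pad m (toList v)
toList-padᵛ zero    v = refl
toList-padᵛ (suc m) v = cong (0 ∷_) (toList-padᵛ m v)

writtenAs-pad : ∀ {n B} m {v : Vec ℕ n} → WrittenAs B v → WrittenAs B (padᵛ m v)
writtenAs-pad {B = B} m {v} (p , eq) = m + p , (begin
  toList (padᵛ m v)          ≡⟨ toList-padᵛ m v ⟩
  pad m (toList v)           ≡⟨ cong (pad m) eq ⟩
  pad m (pad p (columns B))  ≡⟨ pad-+ m p (columns B) ⟩
  pad (m + p) (columns B)    ∎)
  where open ≡-Reasoning

writtenAs-resp : ∀ {n A B} {v : Vec ℕ n} (A≈B : A ≈ᵇ B) →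
                 WrittenAs A v → WrittenAs B (padᵛ (proj₁ A≈B) v)
writtenAs-resp {A = A} {B} {v} (m , m′ , A≈B) (p , eq) = p + m′ , (begin
  toList (padᵛ m v)           ≡⟨ toList-padᵛ m v ⟩
  pad m (toList v)            ≡⟨ cong (pad m) eq ⟩
  pad m (pad p (columns A))   ≡⟨ pad-comm m p (columns A) ⟩
  pad p (pad m (columns A))   ≡⟨ cong (pad p) A≈B ⟩
  pad p (pad m′ (columns B))  ≡⟨ pad-+ p m′ (columns B) ⟩
  pad (p + m′) (columns B)    ∎)
  where open ≡-Reasoning

differ-suc : ∀ {n} {v w : Vec ℕ n} →
             DifferInTwoColumns v w → DifferInTwoColumns (0 Vec.∷ v) (0 Vec.∷ w)
differ-suc (i , j , k , i≢j , 0<k , vi , wj , rest) =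
  Fin.suc i , Fin.suc j , k , (λ { refl → i≢j refl }) , 0<k , vi , wj ,
  λ { Fin.zero    _    _    → refl
    ; (Fin.suc l) l≢i l≢j → rest l (λ { refl → l≢i refl }) (λ { refl → l≢j refl }) }

differ-pad : ∀ {n} {v w : Vec ℕ n} m →
             DifferInTwoColumns v w → DifferInTwoColumns (padᵛ m v) (padᵛ m w)
differ-pad zero    d = d
differ-pad (suc m) d = differ-suc (differ-pad m d)

differ-sym : ∀ {n} → Symmetric (DifferInTwoColumns {n})
differ-sym (i , j , k , i≢j , 0<k , vi , wj , rest) =
  j , i , k , (λ j≡i → i≢j (sym j≡i)) , 0<k , wj , vi ,
  λ l l≢j l≢i → sym (rest l l≢i l≢j)

differ-irrefl : ∀ {n} {v : Vec ℕ n} → ¬ DifferInTwoColumns v v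
differ-irrefl {v = v} (i , _ , suc k , _ , _ , vi , _) =
  m≢1+m+n (lookup v i) (trans vi (+-suc (lookup v i) k))

writtenAs-unique : ∀ {n B} {v w : Vec ℕ n} → WrittenAs B v → WrittenAs B w → v ≡ w
writtenAs-unique {n} {B} {v} {w} (p , v≡) (q , w≡) =
  trans (sym (cast-is-id refl v)) (toList-injective refl v w
    (trans v≡ (trans (cong (λ m → pad m (columns B)) p≡q) (sym w≡))))
  where
  length-pad : ∀ m → length (pad m (columns B)) ≡ m + length (columns B)
  length-pad m = trans (length-++ (replicate m 0)) (cong (_+ length (columns B)) (length-replicate m))

  size : ∀ {m} {u : Vec ℕ n} → toList u ≡ pad m (columns B) → m + length (columns B) ≡ n
  size {m} {u} eq = trans (sym (length-pad m)) (trans (cong length (sym eq)) (length-toList u))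

  p≡q : p ≡ q
  p≡q = +-cancelʳ-≡ (length (columns B)) p q (trans (size {u = v} v≡) (sym (size {u = w} w≡)))

boardAdjacent-respˡ : ∀ {A A′ B} → A ≈ᵇ A′ → BoardAdjacent A B → BoardAdjacent A′ B
boardAdjacent-respˡ {A} {A′} {B} A≈A′ (_ , v , w , Av , Bw , d) =
  _ , _ , _ ,
  writtenAs-resp {A = A} {A′} {v} A≈A′ Av ,
  writtenAs-pad {B = B} (proj₁ A≈A′) {w} Bw ,
  differ-pad (proj₁ A≈A′) d

boardAdjacent-sym : Symmetric BoardAdjacent
boardAdjacent-sym (n , v , w , Av , Bw , d) = n , w , v , Bw , Av , differ-sym {n} {v} {w} d

boardAdjacent-resp : ∀ {A A′ B B′} → A ≈ᵇ A′ → B ≈ᵇ B′ →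
                     BoardAdjacent A B → BoardAdjacent A′ B′
boardAdjacent-resp {A} {A′} {B} {B′} A≈A′ B≈B′ a =
  boardAdjacent-sym {B′} {A′} (boardAdjacent-respˡ {B} {B′} {A′} B≈B′
    (boardAdjacent-sym {A′} {B} (boardAdjacent-respˡ {A} {A′} {B} A≈A′ a)))

boardAdjacent-irrefl : ∀ {A B} → A ≈ᵇ B → ¬ BoardAdjacent A B
boardAdjacent-irrefl {A} {B} A≈B a
  with (_ , v , w , Bv , Bw , d) ← boardAdjacent-respˡ {A} {B} {B} A≈B a
  with refl ← writtenAs-unique {B = B} {v} {w} Bv Bw = differ-irrefl {v = v} d

rookEquivalenceGraph : Board → SimpleGraph
rookEquivalenceGraph B = record
  { vertices   = On.setoid boardSetoid (proj₁ {B = λ A → RookEquivalent A B})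
  ; Adjacent   = λ (A , _) (A′ , _) → BoardAdjacent A A′
  ; adj-resp   = λ {(A , _)} {(A′ , _)} {(C , _)} {(C′ , _)} → boardAdjacent-resp {A} {A′} {C} {C′}
  ; adj-sym    = λ {(A , _)} {(A′ , _)} → boardAdjacent-sym {A} {A′}
  ; adj-irrefl = λ {(A , _)} {(A′ , _)} → boardAdjacent-irrefl {A} {A′}
  }

{-# OPTIONS --safe #-}

module Submission where

-- Record a board by its heights f, counted from the right and followed by zeros.
-- Appending a rightmost column of height c to a board with rook numbers r gives
-- r′ (k+1) = r (k+1) + (c - k) r k, so exchanging the values f l + l of two
-- columns keeps the rook numbers.  Conversely r 1 and r 2 determine the sum of
-- the squares (f l + l)², so every edge of G(B) is such an exchange.
--
-- Let u be the board of the class whose heights strictly decrease until they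
-- reach 0, and suppose G(B) is K₃,₃.  Two consecutive drops of 1 or 2, not both
-- 1, are impossible: (1 , 2) and (2 , 1) give triangles, and (2 , 2) gives two
-- neighbours whose only common neighbour is the board itself.  Then every edge at u
-- exchanges two neighbouring columns with a drop of 2, and the three edges at u
-- do so at three disjoint places.  Two of the exchanges made in succession lead to a
-- board which differs from the third neighbour in three columns, although a path
-- of length 3 joins the two.

open import Defs
import Algebra.Properties.AbelianGroup
open import Data.Bool using (true; false)
open import Data.Empty using (⊥)
open import Data.Fin as Fin using (Fin; fromℕ<; toℕ; opposite)
import Data.Fin.Properties as Fin
open import Data.Integer as ℤ using (ℤ; +_)
import Data.Integer.Properties as ℤ
import Data.Integer.Tactic.RingSolver as ℤ-Solver
open import Data.List
  using (List; []; _∷_; _∷ʳ_; _++_; map; filter; foldr; length; replicate; reverse; applyUpTo; applyDownFrom)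
open import Data.List.Membership.Propositional using (_∈_)
open import Data.List.Membership.Propositional.Properties using (∈-filter⁺; ∈-applyUpTo⁺)
open import Data.List.Properties
open import Data.List.Relation.Binary.Permutation.Propositional using (↭-sym)
open import Data.List.Relation.Binary.Permutation.Propositional.Properties using (All-resp-↭; ↭-reverse)
open import Data.List.Relation.Unary.All as All using (All; []; _∷_; all?)
import Data.List.Relation.Unary.All.Properties as All
open import Data.List.Relation.Unary.AllPairs using (AllPairs; []; _∷_)
import Data.List.Relation.Unary.AllPairs.Properties as AllPairs
open import Data.List.Relation.Unary.Any using (here; there)
open import Data.List.Relation.Unary.Linked as Linked using (Linked; []; [-]; _∷_)
open import Data.List.Relation.Unary.Linked.Properties using (AllPairs⇒Linked)
open import Data.List.Relation.Unary.Sorted.TotalOrder.Properties using (Sorted⇒AllPairs; applyDownFrom⁺₂)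
open import Data.List.Relation.Unary.Unique.Propositional using (Unique)
import Data.List.Relation.Unary.Unique.Propositional.Properties as Unique
open import Data.Nat
open import Data.Nat.Properties
open import Data.Nat.Tactic.RingSolver using (solve-∀)
open import Data.Product using (∃; ∃₂; Σ; _×_; _,_; proj₁; proj₂)
open import Data.Sum as Sum using (_⊎_; inj₁; inj₂)
open import Data.Sum.Properties using (inj₁-injective; inj₂-injective)
open import Data.Unit using (tt)
open import Data.Vec as Vec using (Vec; lookup; toList)
open import Data.Vec.Properties using (length-toList)
open import Function using (_∘_; flip)
open import Function.Bundles using (Inverse; Equivalence)
open import Level using (0ℓ)
open import Relation.Binary using (Rel; Setoid; Tri; tri<; tri≈; tri>)
open import Relation.Binary.PropositionalEquality
open import Relation.Nullary
open import Relation.Unary using (Pred; Decidable)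

private
  module ℤ-Group = Algebra.Properties.AbelianGroup ℤ.+-0-abelianGroup

-- Rook placements

Compatible : Cell → Cell → Set
Compatible c d = proj₁ c ≢ proj₁ d × proj₂ c ≢ proj₂ d

compatible? : ∀ c → Decidable (Compatible c)
compatible? c d = ¬? (proj₁ c ≟ proj₁ d) ×-dec ¬? (proj₂ c ≟ proj₂ d)

-- A rook on the first cell discards the cells that it attacks. This recursion on the list of cells
-- counts placements without listing them, which suits the induction in `#placements-column`.
#placements : ℕ → List Cell → ℕ
#placements zero    cs       = 1
#placements (suc k) []       = 0
#placements (suc k) (c ∷ cs) = #placements k (filter (compatible? c) cs) + #placements (suc k) cs

-- The condition against an already chosen cell can be imposed on the cells before the rest of the
-- placement is chosen, which is how `#placements` counts.
filter-all-combinations : ∀ {A : Set} {P : Pred A 0ℓ} (P? : Decidable P) k xs →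
  filter (all? P?) (combinations k xs) ≡ combinations k (filter P? xs)
filter-all-combinations P? zero    xs = refl
filter-all-combinations P? (suc k) [] = refl
filter-all-combinations P? (suc k) (x ∷ xs) = begin
  filter (all? P?) (map (x ∷_) (combinations k xs) ++ combinations (suc k) xs)
    ≡⟨ filter-++ (all? P?) (map (x ∷_) (combinations k xs)) _ ⟩
  filter (all? P?) (map (x ∷_) (combinations k xs)) ++ filter (all? P?) (combinations (suc k) xs)
    ≡⟨ cong (filter (all? P?) (map (x ∷_) (combinations k xs)) ++_) (filter-all-combinations P? (suc k) xs) ⟩
  filter (all? P?) (map (x ∷_) (combinations k xs)) ++ combinations (suc k) (filter P? xs)
    ≡⟨ head-case ⟩
  combinations (suc k) (filter P? (x ∷ xs)) ∎
  where
  open ≡-Reasoning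
  head-case : filter (all? P?) (map (x ∷_) (combinations k xs)) ++ combinations (suc k) (filter P? xs)
            ≡ combinations (suc k) (filter P? (x ∷ xs))
  head-case with P? x
  ... | yes px = cong (_++ _) (trans (kept (combinations k xs))
                   (cong (map (x ∷_)) (filter-all-combinations P? k xs)))
    where
    kept : ∀ yss → filter (all? P?) (map (x ∷_) yss) ≡ map (x ∷_) (filter (all? P?) yss)
    kept []         = refl
    kept (ys ∷ yss) with P? x | all? P? ys
    ... | no ¬px | _     = contradiction px ¬px
    ... | yes _  | yes _ = cong (_ ∷_) (kept yss)
    ... | yes _  | no _  = kept yss
  ... | no ¬px = cong (_++ _) (dropped (combinations k xs))
    where
    dropped : ∀ yss → filter (all? P?) (map (x ∷_) yss) ≡ []
    dropped []         = refl
    dropped (ys ∷ yss) with P? x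
    ... | yes px = contradiction px ¬px
    ... | no _   = dropped yss

filter-nonAttacking-∷ : ∀ c yss → filter nonAttacking? (map (c ∷_) yss)
                                ≡ map (c ∷_) (filter nonAttacking? (filter (all? (compatible? c)) yss))
filter-nonAttacking-∷ c []         = refl
filter-nonAttacking-∷ c (ys ∷ yss) with does (all? (compatible? c) ys)
... | false = filter-nonAttacking-∷ c yss
... | true with does (nonAttacking? ys)
...   | true  = cong (_ ∷_) (filter-nonAttacking-∷ c yss)
...   | false = filter-nonAttacking-∷ c yss

length-nonAttacking : ∀ k cs → length (filter nonAttacking? (combinations k cs)) ≡ #placements k cs
length-nonAttacking zero    cs       = refl
length-nonAttacking (suc k) []       = refl
length-nonAttacking (suc k) (c ∷ cs) = begin
  length (filter nonAttacking? (map (c ∷_) (combinations k cs) ++ combinations (suc k) cs))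
    ≡⟨ cong length (filter-++ nonAttacking? (map (c ∷_) (combinations k cs)) _) ⟩
  length (filter nonAttacking? (map (c ∷_) (combinations k cs)) ++ filter nonAttacking? (combinations (suc k) cs))
    ≡⟨ length-++ (filter nonAttacking? (map (c ∷_) (combinations k cs))) ⟩
  length (filter nonAttacking? (map (c ∷_) (combinations k cs)))
    + length (filter nonAttacking? (combinations (suc k) cs))
    ≡⟨ cong₂ _+_ with-c (length-nonAttacking (suc k) cs) ⟩
  #placements (suc k) (c ∷ cs) ∎
  where
  open ≡-Reasoning
  with-c : length (filter nonAttacking? (map (c ∷_) (combinations k cs)))
         ≡ #placements k (filter (compatible? c) cs)
  with-c = begin
    length (filter nonAttacking? (map (c ∷_) (combinations k cs)))
      ≡⟨ cong length (filter-nonAttacking-∷ c (combinations k cs)) ⟩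
    length (map (c ∷_) (filter nonAttacking? (filter (all? (compatible? c)) (combinations k cs))))
      ≡⟨ length-map (c ∷_) (filter nonAttacking? (filter (all? (compatible? c)) (combinations k cs))) ⟩
    length (filter nonAttacking? (filter (all? (compatible? c)) (combinations k cs)))
      ≡⟨ cong (length ∘ filter nonAttacking?) (filter-all-combinations (compatible? c) k cs) ⟩
    length (filter nonAttacking? (combinations k (filter (compatible? c) cs)))
      ≡⟨ length-nonAttacking k (filter (compatible? c) cs) ⟩
    #placements k (filter (compatible? c) cs) ∎

#placements-single-column : ∀ k c rows → #placements (2 + k) (map (c ,_) rows) ≡ 0
#placements-single-column k c []         = refl
#placements-single-column k c (r ∷ rows) = cong₂ _+_ blocked (#placements-single-column k c rows)
  where
  blocked : #placements (suc k) (filter (compatible? (c , r)) (map (c ,_) rows)) ≡ 0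
  blocked = cong (#placements (suc k))
    (filter-none (compatible? (c , r)) {map (c ,_) rows}
      (All.map⁺ (All.universal (λ _ (c≢c , _) → c≢c refl) rows)))

#placements-1 : ∀ cs → #placements 1 cs ≡ length cs
#placements-1 []       = refl
#placements-1 (c ∷ cs) = cong suc (#placements-1 cs)

filter-compatible-column : ∀ {c d} → proj₁ d ≢ c → ∀ rows →
  filter (compatible? d) (map (c ,_) rows) ≡ map (c ,_) (filter (λ r → ¬? (proj₂ d ≟ r)) rows)
filter-compatible-column {c} {d} d≢c []         = refl
filter-compatible-column {c} {d} d≢c (r ∷ rows) with proj₂ d ≟ r
... | yes d≡r = trans (filter-reject (compatible? d) (λ (_ , d≢r) → d≢r d≡r))
  (trans (filter-compatible-column d≢c rows)
    (cong (map (c ,_)) (sym (filter-reject (λ r → ¬? (proj₂ d ≟ r)) (contradiction d≡r)))))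
... | no d≢r  = trans (filter-accept (compatible? d) (d≢c , d≢r))
  (trans (cong ((c , r) ∷_) (filter-compatible-column d≢c rows))
    (cong (map (c ,_)) (sym (filter-accept (λ r → ¬? (proj₂ d ≟ r)) d≢r))))

length-filter-≢ : ∀ {r rows} → Unique rows → r ∈ rows →
                  suc (length (filter (λ r′ → ¬? (r ≟ r′)) rows)) ≡ length rows
length-filter-≢ {r} (r∉ ∷ u) (here refl) =
  cong (suc ∘ length) (trans (filter-reject (λ r′ → ¬? (r ≟ r′)) (contradiction refl))
                             (filter-all (λ r′ → ¬? (r ≟ r′)) r∉))
length-filter-≢ {r} (s∉ ∷ u) (there r∈) =
  cong suc (trans (cong length (filter-accept (λ r′ → ¬? (r ≟ r′)) (≢-sym (All.lookup s∉ r∈))))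
                  (length-filter-≢ u r∈))

-- If `rows` has no repetitions, the second condition makes a rook on such a cell attack exactly one
-- cell of column `c`, the one in its row.
OutsideColumn : ℕ → List ℕ → Cell → Set
OutsideColumn c rows d = proj₁ d ≢ c × proj₂ d ∈ rows

-- A placement of k rooks on cs blocks exactly k cells of the new column.
#placements-column : ∀ k c {rows cs} → Unique rows → All (OutsideColumn c rows) cs →
  #placements (suc k) (cs ++ map (c ,_) rows) + k * #placements k cs
  ≡ #placements (suc k) cs + length rows * #placements k cs
#placements-column zero    c {rows} {[]}     u outs =
  trans (+-identityʳ _) (trans (#placements-1 (map (c ,_) rows))
    (trans (length-map (c ,_) rows) (sym (*-identityʳ _))))
#placements-column (suc k) c {rows} {[]}     u outs =
  trans (cong₂ _+_ (#placements-single-column k c rows) (*-zeroʳ k)) (sym (*-zeroʳ (length rows)))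
#placements-column zero    c {rows} {d ∷ cs} u (_ ∷ outs) = cong suc (#placements-column zero c u outs)
#placements-column (suc k) c {rows} {d ∷ cs} u ((d≢c , d∈) ∷ outs) = begin
  #placements (suc k) (filter (compatible? d) (cs ++ map (c ,_) rows)) + X + suc k * (P + Q)
    ≡⟨ cong (λ ds → #placements (suc k) ds + X + suc k * (P + Q)) filter-split ⟩
  Y + X + suc k * (P + Q)
    -- A rook on `d` costs the new column the row of `d`, so the induction hypothesis for `cs′` has
    -- one row fewer. The spare `P` makes up for that row.
    ≡⟨ regroup k Y X P Q ⟩
  (Y + k * P) + (X + suc k * Q) + P
    ≡⟨ cong₂ (λ y x → y + x + P)
         (#placements-column k c u′ outs′) (#placements-column (suc k) c u outs) ⟩
  (R + length rows′ * P) + (S + length rows * Q) + P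
    ≡⟨ cong (λ l → (R + length rows′ * P) + (S + l * Q) + P) (sym shorter) ⟩
  (R + length rows′ * P) + (S + suc (length rows′) * Q) + P
    ≡⟨ regroup′ (length rows′) R P S Q ⟩
  (R + S) + suc (length rows′) * (P + Q)
    ≡⟨ cong (λ l → (R + S) + l * (P + Q)) shorter ⟩
  (R + S) + length rows * (P + Q) ∎
  where
  open ≡-Reasoning
  rows′ = filter (λ r → ¬? (proj₂ d ≟ r)) rows
  cs′   = filter (compatible? d) cs
  X = #placements (2 + k) (cs ++ map (c ,_) rows)
  Y = #placements (suc k) (cs′ ++ map (c ,_) rows′)
  P = #placements k cs′
  Q = #placements (suc k) cs
  R = #placements (suc k) cs′
  S = #placements (2 + k) cs

  filter-split : filter (compatible? d) (cs ++ map (c ,_) rows) ≡ cs′ ++ map (c ,_) rows′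
  filter-split = trans (filter-++ (compatible? d) cs _) (cong (cs′ ++_) (filter-compatible-column d≢c rows))

  shorter : suc (length rows′) ≡ length rows
  shorter = length-filter-≢ u d∈

  u′ : Unique rows′
  u′ = Unique.filter⁺ _ u

  outs′ : All (OutsideColumn c rows′) cs′
  outs′ = All.zipWith
    (λ ((e≢c , e∈) , (_ , d≢e)) → e≢c , ∈-filter⁺ (λ r → ¬? (proj₂ d ≟ r)) e∈ d≢e)
    (All.filter⁺ (compatible? d) outs , All.all-filter (compatible? d) cs)

  regroup : ∀ k Y X P Q → Y + X + suc k * (P + Q) ≡ (Y + k * P) + (X + suc k * Q) + P
  regroup = solve-∀

  regroup′ : ∀ l R P S Q → (R + l * P) + (S + suc l * Q) + P ≡ (R + S) + suc l * (P + Q)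
  regroup′ = solve-∀

cellsFrom-∷ʳ : ∀ i bs b →
  cellsFrom i (bs ∷ʳ b) ≡ cellsFrom i bs ++ map (i + length bs ,_) (applyUpTo suc b)
cellsFrom-∷ʳ i []       b = begin
  applyUpTo (λ r → i , suc r) b ++ []  ≡⟨ ++-identityʳ _ ⟩
  applyUpTo (λ r → i , suc r) b        ≡⟨ map-applyUpTo suc (i ,_) b ⟨
  map (i ,_) (applyUpTo suc b)         ≡⟨ cong (λ j → map (j ,_) (applyUpTo suc b)) (+-identityʳ i) ⟨
  map (i + 0 ,_) (applyUpTo suc b)     ∎
  where open ≡-Reasoning
cellsFrom-∷ʳ i (a ∷ bs) b = begin
  column ++ cellsFrom (suc i) (bs ∷ʳ b)
    ≡⟨ cong (column ++_) (cellsFrom-∷ʳ (suc i) bs b) ⟩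
  column ++ (cellsFrom (suc i) bs ++ lastColumn (suc i + length bs))
    ≡⟨ ++-assoc column _ _ ⟨
  (column ++ cellsFrom (suc i) bs) ++ lastColumn (suc i + length bs)
    ≡⟨ cong (λ j → (column ++ cellsFrom (suc i) bs) ++ lastColumn j) (sym (+-suc i (length bs))) ⟩
  (column ++ cellsFrom (suc i) bs) ++ lastColumn (i + suc (length bs)) ∎
  where
  open ≡-Reasoning
  column = applyUpTo (λ r → i , suc r) a
  lastColumn : ℕ → List Cell
  lastColumn j = map (j ,_) (applyUpTo suc b)

-- The shape of a Ferrers board enters here: the last column is at least as high as the others, so
-- it meets every row that they use.
cellsFrom-outside : ∀ i {b bs} → All (_≤ b) bs →
                    All (OutsideColumn (i + length bs) (applyUpTo suc b)) (cellsFrom i bs)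
cellsFrom-outside i []                              = []
cellsFrom-outside i {b} {a ∷ bs} (a≤b ∷ bs≤b) = All.++⁺
  (All.applyUpTo⁺₁ _ a λ r<a → <⇒≢ (m<m+n i z<s) , ∈-applyUpTo⁺ suc (<-≤-trans r<a a≤b))
  (subst (λ j → All (OutsideColumn j (applyUpTo suc b)) (cellsFrom (suc i) bs))
         (sym (+-suc i (length bs))) (cellsFrom-outside (suc i) bs≤b))

-- The recursion for rook numbers

All-reverse⁺ : ∀ {A : Set} {P : Pred A 0ℓ} {xs} → All P xs → All P (reverse xs)
All-reverse⁺ {xs = xs} = All-resp-↭ (↭-sym (↭-reverse xs))

-- Column heights are listed from the right here, so for a board they weakly decrease.
-- In the other cases the integer factor may be negative and rooks counts nothing,
-- but the exchange law below still holds.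
rooks : List ℕ → ℕ → ℤ
rooks []       zero    = + 1
rooks []       (suc k) = + 0
rooks (b ∷ bs) zero    = rooks bs zero
rooks (b ∷ bs) (suc k) = rooks bs (suc k) ℤ.+ (+ b ℤ.- + k) ℤ.* rooks bs k

rooks-∷-cong : ∀ b {bs cs} → rooks bs ≗ rooks cs → rooks (b ∷ bs) ≗ rooks (b ∷ cs)
rooks-∷-cong b eq zero    = eq zero
rooks-∷-cong b eq (suc k) = cong₂ (λ x y → x ℤ.+ (+ b ℤ.- + k) ℤ.* y) (eq (suc k)) (eq k)

-- The added entry is a padding column on the far left. Its factor is 0 at `k = 0`, and for larger
-- `k` it multiplies a vanishing rook number of the empty board.
rooks-∷ʳ-0 : ∀ bs → rooks (bs ∷ʳ 0) ≗ rooks bs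
rooks-∷ʳ-0 []       zero          = refl
rooks-∷ʳ-0 []       (suc zero)    = refl
rooks-∷ʳ-0 []       (suc (suc k)) = trans (ℤ.+-identityˡ _) (ℤ.*-zeroʳ (+ 0 ℤ.- + suc k))
rooks-∷ʳ-0 (b ∷ bs) = rooks-∷-cong b (rooks-∷ʳ-0 bs)

-- In terms of the numbers h + i, with i the index of the column of height h, the
-- exchange is a transposition.
rooks-exchange : ∀ a b bs → rooks (suc a ∷ b ∷ bs) ≗ rooks (suc b ∷ a ∷ bs)
rooks-exchange a b bs zero          = refl
rooks-exchange a b bs (suc zero)    = identity (+ a) (+ b) (rooks bs 1) (rooks bs 0)
  where
  identity : ∀ a b x y →
    (x ℤ.+ (b ℤ.- + 0) ℤ.* y) ℤ.+ ((+ 1 ℤ.+ a) ℤ.- + 0) ℤ.* y ≡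
    (x ℤ.+ (a ℤ.- + 0) ℤ.* y) ℤ.+ ((+ 1 ℤ.+ b) ℤ.- + 0) ℤ.* y
  identity = ℤ-Solver.solve-∀
rooks-exchange a b bs (suc (suc k)) =
  identity (+ a) (+ b) (+ k) (rooks bs (2 + k)) (rooks bs (suc k)) (rooks bs k)
  where
  identity : ∀ a b k x y z →
    (x ℤ.+ (b ℤ.- (+ 1 ℤ.+ k)) ℤ.* y) ℤ.+ ((+ 1 ℤ.+ a) ℤ.- (+ 1 ℤ.+ k)) ℤ.* (y ℤ.+ (b ℤ.- k) ℤ.* z) ≡
    (x ℤ.+ (a ℤ.- (+ 1 ℤ.+ k)) ℤ.* y) ℤ.+ ((+ 1 ℤ.+ b) ℤ.- (+ 1 ℤ.+ k)) ℤ.* (y ℤ.+ (a ℤ.- k) ℤ.* z)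
  identity = ℤ-Solver.solve-∀

#placements-rooks : ∀ {bs} → AllPairs _≥_ bs → ∀ k → + #placements k (cellsFrom 1 (reverse bs)) ≡ rooks bs k
#placements-rooks []                    zero    = refl
#placements-rooks []                    (suc k) = refl
#placements-rooks {b ∷ bs} (bs≤b ∷ dec) zero    = #placements-rooks dec zero
#placements-rooks {b ∷ bs} (bs≤b ∷ dec) (suc k) = begin
  + #placements (suc k) (cellsFrom 1 (reverse (b ∷ bs)))
    ≡⟨ cong (λ cs → + #placements (suc k) (cellsFrom 1 cs)) (unfold-reverse b bs) ⟩
  + #placements (suc k) (cellsFrom 1 (reverse bs ∷ʳ b))
    ≡⟨ cong (λ cs → + #placements (suc k) cs) (cellsFrom-∷ʳ 1 (reverse bs) b) ⟩
  + X
    -- The law for `#placements` is additive over ℕ; `X` alone is recovered from it in ℤ.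
    ≡⟨ solve-for (+ X) (+ k) (+ P) ⟨
  (+ X ℤ.+ + k ℤ.* + P) ℤ.- + k ℤ.* + P
    ≡⟨ cong (ℤ._- + k ℤ.* + P) column ⟩
  (+ Q ℤ.+ + b ℤ.* + P) ℤ.- + k ℤ.* + P
    ≡⟨ collect (+ Q) (+ b) (+ k) (+ P) ⟩
  + Q ℤ.+ (+ b ℤ.- + k) ℤ.* + P
    ≡⟨ cong₂ (λ x y → x ℤ.+ (+ b ℤ.- + k) ℤ.* y) (#placements-rooks dec (suc k)) (#placements-rooks dec k) ⟩
  rooks (b ∷ bs) (suc k) ∎
  where
  open ≡-Reasoning
  rest = cellsFrom 1 (reverse bs)
  X = #placements (suc k) (rest ++ map (1 + length (reverse bs) ,_) (applyUpTo suc b))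
  P = #placements k rest
  Q = #placements (suc k) rest

  column : + X ℤ.+ + k ℤ.* + P ≡ + Q ℤ.+ + b ℤ.* + P
  column = begin
    + X ℤ.+ + k ℤ.* + P  ≡⟨ cong (ℤ._+_ (+ X)) (ℤ.pos-* k P) ⟨
    + (X + k * P)        ≡⟨ cong +_ (#placements-column k _
                              (Unique.applyUpTo⁺₁ suc b (λ i<j _ → <⇒≢ i<j ∘ suc-injective))
                              (cellsFrom-outside 1 (All-reverse⁺ bs≤b))) ⟩
    + (Q + length (applyUpTo suc b) * P)
                         ≡⟨ cong (λ l → + (Q + l * P)) (length-applyUpTo suc b) ⟩
    + (Q + b * P)        ≡⟨ cong (ℤ._+_ (+ Q)) (ℤ.pos-* b P) ⟩
    + Q ℤ.+ + b ℤ.* + P  ∎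

  solve-for : ∀ x k p → (x ℤ.+ k ℤ.* p) ℤ.- k ℤ.* p ≡ x
  solve-for = ℤ-Solver.solve-∀

  collect : ∀ q b k p → (q ℤ.+ b ℤ.* p) ℤ.- k ℤ.* p ≡ q ℤ.+ (b ℤ.- k) ℤ.* p
  collect = ℤ-Solver.solve-∀

AllPairs-reverse⁺ : ∀ {A : Set} {R : Rel A 0ℓ} {xs} → AllPairs R xs → AllPairs (flip R) (reverse xs)
AllPairs-reverse⁺ []                            = []
AllPairs-reverse⁺ {R = R} {x ∷ xs} (Rx ∷ Rxs) = subst (AllPairs (flip R)) (sym (unfold-reverse x xs))
  (AllPairs.++⁺ (AllPairs-reverse⁺ Rxs) ([] ∷ []) (All.map (_∷ []) (All-reverse⁺ Rx)))

rookNumber-rooks : ∀ k B → + rookNumber k B ≡ rooks (reverse (columns B)) k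
rookNumber-rooks k B = begin
  + rookNumber k B
    ≡⟨ cong +_ (length-nonAttacking k (cells B)) ⟩
  + #placements k (cellsFrom 1 (columns B))
    ≡⟨ cong (λ cs → + #placements k (cellsFrom 1 cs)) (reverse-involutive (columns B)) ⟨
  + #placements k (cellsFrom 1 (reverse (reverse (columns B))))
    ≡⟨ #placements-rooks (AllPairs-reverse⁺ (Sorted⇒AllPairs ≤-totalOrder (increasing B))) k ⟩
  rooks (reverse (columns B)) k ∎
  where open ≡-Reasoning

-- The falling board of a rook equivalence class

infix 4 _↘_

-- The second case admits repeated zeros, so that padding does not disturb an otherwise strict
-- descent.
_↘_ : Rel ℕ 0ℓ
a ↘ b = b < a ⊎ b ≡ 0

↘⇒≥ : ∀ {a b} → a ↘ b → a ≥ b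
↘⇒≥ (inj₁ b<a)  = <⇒≤ b<a
↘⇒≥ (inj₂ refl) = z≤n

-- Insertion by exchanges: a new rightmost column of height c is moved to the left
-- until the heights fall.
insert : ℕ → List ℕ → List ℕ
insert c []           = c ∷ []
insert c (zero ∷ bs)  = c ∷ zero ∷ bs
insert c (suc b ∷ bs) with suc b <? c
... | yes _ = c ∷ suc b ∷ bs
... | no  _ = suc (suc b) ∷ insert (pred c) bs

straighten : List ℕ → List ℕ
straighten = foldr insert []

-- A bound `length bs ≤ c + zeros bs` says without subtraction that at most `c` columns are
-- positive.
zeros : List ℕ → ℕ
zeros []           = 0
zeros (zero ∷ bs)  = suc (zeros bs)
zeros (suc _ ∷ bs) = zeros bs

zeros≤length : ∀ bs → zeros bs ≤ length bs
zeros≤length []           = z≤n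
zeros≤length (zero ∷ bs)  = s≤s (zeros≤length bs)
zeros≤length (suc _ ∷ bs) = m≤n⇒m≤1+n (zeros≤length bs)

length-insert : ∀ c bs → length (insert c bs) ≡ suc (length bs)
length-insert c []           = refl
length-insert c (zero ∷ bs)  = refl
length-insert c (suc b ∷ bs) with suc b <? c
... | yes _ = refl
... | no  _ = cong suc (length-insert (pred c) bs)

-- The hypothesis ensures that insert never takes the predecessor of 0.
rooks-insert : ∀ c bs → length bs ≤ c + zeros bs → rooks (insert c bs) ≗ rooks (c ∷ bs)
rooks-insert c       []           fits k = refl
rooks-insert c       (zero ∷ bs)  fits k = refl
rooks-insert c       (suc b ∷ bs) fits k with suc b <? c
... | yes _ = refl
rooks-insert zero    (suc b ∷ bs) fits k | no _ = contradiction (zeros≤length bs) (<⇒≱ fits)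
rooks-insert (suc c) (suc b ∷ bs) fits k | no _ =
  trans (rooks-∷-cong (suc (suc b)) (rooks-insert c bs (≤-pred fits)) k) (rooks-exchange (suc b) c bs k)

-- This is the situation after one exchange: the column of height `v` has grown to `suc v`. Knowing
-- `c < v` keeps the descent strict whether the insertion stops or goes on.
falling-insert-∷ : ∀ {v} c {bs} → c < v → Linked _↘_ (v ∷ bs) → Linked _↘_ (suc v ∷ insert c bs)
falling-insert-∷ c {[]}         c<v _          = inj₁ (m<n⇒m<1+n c<v) ∷ [-]
falling-insert-∷ c {zero ∷ bs}  c<v (_ ∷ fall) = inj₁ (m<n⇒m<1+n c<v) ∷ inj₂ refl ∷ fall
falling-insert-∷ c {suc b ∷ bs} c<v (v↘b ∷ fall) with suc b <? c | v↘b
... | yes b<c | _        = inj₁ (m<n⇒m<1+n c<v) ∷ inj₁ b<c ∷ fall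
... | no  b≮c | inj₁ b<v = inj₁ (s<s b<v) ∷ falling-insert-∷ (pred c) (s≤s (pred-mono-≤ (≮⇒≥ b≮c))) fall

falling-insert : ∀ c {bs} → Linked _↘_ bs → Linked _↘_ (insert c bs)
falling-insert c {[]}         fall = [-]
falling-insert c {zero ∷ bs}  fall = inj₂ refl ∷ fall
falling-insert c {suc b ∷ bs} fall with suc b <? c
... | yes b<c = inj₁ b<c ∷ fall
... | no  b≮c = falling-insert-∷ (pred c) (s≤s (pred-mono-≤ (≮⇒≥ b≮c))) fall

falling-straighten : ∀ bs → Linked _↘_ (straighten bs)
falling-straighten []       = []
falling-straighten (b ∷ bs) = falling-insert b (falling-straighten bs)

-- Strict descent from `b` reaches 0 within `b` steps, so at most `b` columns are positive.
length-falling : ∀ {b bs} → Linked _↘_ (b ∷ bs) → length (b ∷ bs) ≤ b + zeros (b ∷ bs)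
length-falling {zero}  [-]                       = ≤-refl
length-falling {suc b} [-]                       = s≤s z≤n
length-falling {zero}  (inj₂ refl ∷ fall)        = s≤s (length-falling fall)
length-falling {suc b} {a ∷ bs} (inj₁ a<b ∷ fall) =
  s≤s (≤-trans (length-falling fall) (+-monoˡ-≤ (zeros (a ∷ bs)) (≤-pred a<b)))
length-falling {suc b} {zero ∷ bs} (inj₂ refl ∷ fall) =
  s≤s (≤-trans (length-falling fall) (m≤n+m (zeros (zero ∷ bs)) b))

-- Carries the bound on positive columns through the straightening: the next column to the right is
-- at least as high as `c`, so it can be inserted too. Each exchange uses up one positive column and
-- one unit of `c`.
length-zeros-insert : ∀ c {bs} → Linked _↘_ bs → length bs ≤ c + zeros bs →
                      suc (length bs) ≤ c + zeros (insert c bs)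
length-zeros-insert c       {[]}         fall fits = length-falling {c} [-]
length-zeros-insert c       {zero ∷ bs}  fall fits = length-falling {c} (inj₂ refl ∷ fall)
length-zeros-insert c       {suc b ∷ bs} fall fits with suc b <? c
... | yes b<c = length-falling (inj₁ b<c ∷ fall)
length-zeros-insert zero    {suc b ∷ bs} fall fits | no _ = contradiction (zeros≤length bs) (<⇒≱ fits)
length-zeros-insert (suc c) {suc b ∷ bs} fall fits | no _ =
  s≤s (length-zeros-insert c (Linked.tail fall) (≤-pred fits))

straighten-fits : ∀ {c bs} → Linked _≥_ (c ∷ bs) → length (straighten bs) ≤ c + zeros (straighten bs)
straighten-fits [-]                          = z≤n
straighten-fits {c} {b ∷ bs} (b≤c ∷ dec) = begin
  length (straighten (b ∷ bs))     ≡⟨ length-insert b (straighten bs) ⟩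
  suc (length (straighten bs))     ≤⟨ length-zeros-insert b (falling-straighten bs) (straighten-fits dec) ⟩
  b + zeros (straighten (b ∷ bs))  ≤⟨ +-monoˡ-≤ _ b≤c ⟩
  c + zeros (straighten (b ∷ bs))  ∎
  where open ≤-Reasoning

rooks-straighten : ∀ {bs} → Linked _≥_ bs → rooks (straighten bs) ≗ rooks bs
rooks-straighten {[]}     _   k = refl
rooks-straighten {b ∷ bs} dec k =
  trans (rooks-insert b (straighten bs) (straighten-fits dec) k)
        (rooks-∷-cong b (rooks-straighten (Linked.tail dec)) k)

-- Rook numbers and the sum of squares

-- The parameter `s` is the index of the first column and varies in the induction; `s = 0` gives the
-- sum of the `(f l + l)²`.
sumOfSquares : ℕ → List ℕ → ℕ
sumOfSquares s []       = 0
sumOfSquares s (b ∷ bs) = (b + s) * (b + s) + sumOfSquares (suc s) bs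

rooks-0 : ∀ bs → rooks bs 0 ≡ + 1
rooks-0 []       = refl
rooks-0 (b ∷ bs) = rooks-0 bs

-- By the recursion `r₁` is the sum of the heights, and `2 r₂` is `r₁²` less the sum of
-- `b² + 2 i b`, where `i` columns lie to the right of the one of height `b`. Completing the squares
-- `(b + i + s)²` adds `2 s r₁` and the `replicate` term, which depends only on `s` and the number
-- of columns.
rooks-sumOfSquares : ∀ s bs → let r₁ = rooks bs 1 in
  + 2 ℤ.* rooks bs 2 ℤ.+ + sumOfSquares s bs ≡
  r₁ ℤ.* r₁ ℤ.+ + 2 ℤ.* + s ℤ.* r₁ ℤ.+ + sumOfSquares s (replicate (length bs) 0)
rooks-sumOfSquares s []       =
  sym (trans (ℤ.+-identityʳ _) (trans (ℤ.+-identityˡ _) (ℤ.*-zeroʳ (+ 2 ℤ.* + s))))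
rooks-sumOfSquares s (b ∷ bs) = begin
  + 2 ℤ.* (r₂ ℤ.+ (+ b ℤ.- + 1) ℤ.* r₁) ℤ.+ (+ ((b + s) * (b + s)) ℤ.+ q)
    ≡⟨ cong (λ x → + 2 ℤ.* (r₂ ℤ.+ (+ b ℤ.- + 1) ℤ.* r₁) ℤ.+ (x ℤ.+ q)) (ℤ.pos-* (b + s) (b + s)) ⟩
  + 2 ℤ.* (r₂ ℤ.+ (+ b ℤ.- + 1) ℤ.* r₁) ℤ.+ ((+ b ℤ.+ + s) ℤ.* (+ b ℤ.+ + s) ℤ.+ q)
    ≡⟨ regroup (+ b) (+ s) r₁ r₂ q ⟩
  (+ 2 ℤ.* r₂ ℤ.+ q) ℤ.+ added
    ≡⟨ cong (ℤ._+ added) (rooks-sumOfSquares (suc s) bs) ⟩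
  (r₁ ℤ.* r₁ ℤ.+ + 2 ℤ.* (+ 1 ℤ.+ + s) ℤ.* r₁ ℤ.+ c) ℤ.+ added
    ≡⟨ complete (+ b) (+ s) r₁ c ⟩
  total (r₁ ℤ.+ (+ b ℤ.- + 0) ℤ.* + 1) (+ s ℤ.* + s)
    ≡⟨ cong₂ (λ o x → total (r₁ ℤ.+ (+ b ℤ.- + 0) ℤ.* o) x) (rooks-0 bs) (ℤ.pos-* s s) ⟨
  total (rooks (b ∷ bs) 1) (+ (s * s)) ∎
  where
  open ≡-Reasoning
  r₁    = rooks bs 1
  r₂    = rooks bs 2
  q     = + sumOfSquares (suc s) bs
  c     = + sumOfSquares (suc s) (replicate (length bs) 0)
  added = + 2 ℤ.* (+ b ℤ.- + 1) ℤ.* r₁ ℤ.+ (+ b ℤ.+ + s) ℤ.* (+ b ℤ.+ + s)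

  total : ℤ → ℤ → ℤ
  total r x = r ℤ.* r ℤ.+ + 2 ℤ.* + s ℤ.* r ℤ.+ (x ℤ.+ c)

  regroup : ∀ b s x y q → + 2 ℤ.* (y ℤ.+ (b ℤ.- + 1) ℤ.* x) ℤ.+ ((b ℤ.+ s) ℤ.* (b ℤ.+ s) ℤ.+ q) ≡
    (+ 2 ℤ.* y ℤ.+ q) ℤ.+ (+ 2 ℤ.* (b ℤ.- + 1) ℤ.* x ℤ.+ (b ℤ.+ s) ℤ.* (b ℤ.+ s))
  regroup = ℤ-Solver.solve-∀

  complete : ∀ b s x c →
    (x ℤ.* x ℤ.+ + 2 ℤ.* (+ 1 ℤ.+ s) ℤ.* x ℤ.+ c) ℤ.+
      (+ 2 ℤ.* (b ℤ.- + 1) ℤ.* x ℤ.+ (b ℤ.+ s) ℤ.* (b ℤ.+ s)) ≡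
    (x ℤ.+ (b ℤ.- + 0) ℤ.* + 1) ℤ.* (x ℤ.+ (b ℤ.- + 0) ℤ.* + 1) ℤ.+
      + 2 ℤ.* s ℤ.* (x ℤ.+ (b ℤ.- + 0) ℤ.* + 1) ℤ.+ (s ℤ.* s ℤ.+ c)
  complete = ℤ-Solver.solve-∀

sumOfSquares-unique : ∀ {as bs} → length as ≡ length bs → rooks as ≗ rooks bs →
                      sumOfSquares 0 as ≡ sumOfSquares 0 bs
sumOfSquares-unique {as} {bs} len eq = ℤ.+-injective (ℤ-Group.∙-cancelˡ (+ 2 ℤ.* rooks as 2) _ _ (begin
  + 2 ℤ.* rooks as 2 ℤ.+ + sumOfSquares 0 as  ≡⟨ rooks-sumOfSquares 0 as ⟩
  invariant (rooks as 1) (length as)          ≡⟨ cong₂ invariant (eq 1) len ⟩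
  invariant (rooks bs 1) (length bs)          ≡⟨ rooks-sumOfSquares 0 bs ⟨
  + 2 ℤ.* rooks bs 2 ℤ.+ + sumOfSquares 0 bs  ≡⟨ cong (λ r → + 2 ℤ.* r ℤ.+ + sumOfSquares 0 bs) (eq 2) ⟨
  + 2 ℤ.* rooks as 2 ℤ.+ + sumOfSquares 0 bs  ∎))
  where
  open ≡-Reasoning
  invariant : ℤ → ℕ → ℤ
  invariant r n = r ℤ.* r ℤ.+ + 2 ℤ.* + 0 ℤ.* r ℤ.+ + sumOfSquares 0 (replicate n 0)

-- Heights counted from the right

heightAt : List ℕ → ℕ → ℕ
heightAt []       _       = 0
heightAt (b ∷ bs) zero    = b
heightAt (b ∷ bs) (suc i) = heightAt bs i

-- Columns are counted from the right, so that padding is invisible.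
height : Board → ℕ → ℕ
height B = heightAt (reverse (columns B))

Decreasing : (ℕ → ℕ) → Set
Decreasing f = ∀ i → f (suc i) ≤ f i

width : Board → ℕ
width B = length (columns B)

heightAt-beyond : ∀ bs {i} → length bs ≤ i → heightAt bs i ≡ 0
heightAt-beyond []       _         = refl
heightAt-beyond (b ∷ bs) (s≤s len≤i) = heightAt-beyond bs len≤i

height-beyond : ∀ B {i} → width B ≤ i → height B i ≡ 0
height-beyond B w≤i = heightAt-beyond (reverse (columns B)) (subst (_≤ _) (sym (length-reverse (columns B))) w≤i)

height-positive⇒< : ∀ B {i} → 0 < height B i → i < width B
height-positive⇒< B {i} 0<h with i <? width B
... | yes i<w = i<w
... | no  i≮w = contradiction (height-beyond B (≮⇒≥ i≮w)) (≢-sym (<⇒≢ 0<h))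

applyUpTo-cong : ∀ {f g : ℕ → ℕ} → f ≗ g → ∀ n → applyUpTo f n ≡ applyUpTo g n
applyUpTo-cong f≗g zero    = refl
applyUpTo-cong f≗g (suc n) = cong₂ _∷_ (f≗g 0) (applyUpTo-cong (f≗g ∘ suc) n)

applyUpTo-heightAt : ∀ bs m → applyUpTo (heightAt bs) (length bs + m) ≡ bs ++ replicate m 0
applyUpTo-heightAt []       zero    = refl
applyUpTo-heightAt []       (suc m) = cong (0 ∷_) (applyUpTo-heightAt [] m)
applyUpTo-heightAt (b ∷ bs) m       = cong (b ∷_) (applyUpTo-heightAt bs m)

heightAt-applyUpTo : ∀ {f} n → (∀ {i} → n ≤ i → f i ≡ 0) → heightAt (applyUpTo f n) ≗ f
heightAt-applyUpTo zero    f≡0 i       = sym (f≡0 z≤n)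
heightAt-applyUpTo (suc n) f≡0 zero    = refl
heightAt-applyUpTo (suc n) f≡0 (suc i) = heightAt-applyUpTo n (f≡0 ∘ s≤s) i

heightAt-decreasing : ∀ {bs} → Linked _≥_ bs → Decreasing (heightAt bs)
heightAt-decreasing []          i       = z≤n
heightAt-decreasing [-]         i       = z≤n
heightAt-decreasing (a≥b ∷ dec) zero    = a≥b
heightAt-decreasing (a≥b ∷ dec) (suc i) = heightAt-decreasing dec i

heightAt-falling : ∀ {bs} → Linked _↘_ bs → ∀ i → heightAt bs i ↘ heightAt bs (suc i)
heightAt-falling []           i       = inj₂ refl
heightAt-falling [-]          i       = inj₂ refl
heightAt-falling (a↘b ∷ fall) zero    = a↘b
heightAt-falling (a↘b ∷ fall) (suc i) = heightAt-falling fall i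

columns-decreasing : ∀ B → Linked _≥_ (reverse (columns B))
columns-decreasing B = AllPairs⇒Linked (AllPairs-reverse⁺ (Sorted⇒AllPairs ≤-totalOrder (increasing B)))

height-decreasing : ∀ B → Decreasing (height B)
height-decreasing B = heightAt-decreasing (columns-decreasing B)

reverse-replicate : ∀ {A : Set} m (x : A) → reverse (replicate m x) ≡ replicate m x
reverse-replicate m x = trans (cong reverse (sym (constant m)))
  (trans (reverse-applyUpTo (λ _ → x) m) (constant′ m))
  where
  constant : ∀ m → applyUpTo (λ _ → x) m ≡ replicate m x
  constant zero    = refl
  constant (suc m) = cong (x ∷_) (constant m)
  constant′ : ∀ m → applyDownFrom (λ _ → x) m ≡ replicate m x
  constant′ zero    = refl
  constant′ (suc m) = cong (x ∷_) (constant′ m)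

reverse-pad : ∀ m bs → reverse (pad m bs) ≡ reverse bs ++ replicate m 0
reverse-pad m bs = trans (reverse-++ (replicate m 0) bs) (cong (reverse bs ++_) (reverse-replicate m 0))

applyUpTo-height : ∀ B m → applyUpTo (height B) (width B + m) ≡ reverse (columns B) ++ replicate m 0
applyUpTo-height B m = subst (λ n → applyUpTo (height B) (n + m) ≡ reverse (columns B) ++ replicate m 0)
  (length-reverse (columns B)) (applyUpTo-heightAt (reverse (columns B)) m)

pad-columns : ∀ B m → pad m (columns B) ≡ applyDownFrom (height B) (width B + m)
pad-columns B m = reverse-injective (trans (reverse-pad m (columns B))
  (trans (sym (applyUpTo-height B m)) (sym (reverse-applyDownFrom (height B) (width B + m)))))

applyDownFrom-cong : ∀ {f g : ℕ → ℕ} → f ≗ g → ∀ n → applyDownFrom f n ≡ applyDownFrom g n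
applyDownFrom-cong f≗g zero    = refl
applyDownFrom-cong f≗g (suc n) = cong₂ _∷_ (f≗g n) (applyDownFrom-cong f≗g n)

height≗⇒≈ᵇ : ∀ {A B} → height A ≗ height B → A ≈ᵇ B
-- Padding each board by the width of the other gives both the same number of columns.
height≗⇒≈ᵇ {A} {B} A≗B = width B , width A , (begin
  pad (width B) (columns A)                    ≡⟨ pad-columns A (width B) ⟩
  applyDownFrom (height A) (width A + width B) ≡⟨ applyDownFrom-cong A≗B _ ⟩
  applyDownFrom (height B) (width A + width B) ≡⟨ cong (applyDownFrom (height B)) (+-comm (width A) (width B)) ⟩
  applyDownFrom (height B) (width B + width A) ≡⟨ pad-columns B (width A) ⟨
  pad (width A) (columns B)                    ∎)
  where open ≡-Reasoning

opposite-injective : ∀ {n} {i j : Fin n} → opposite i ≡ opposite j → i ≡ j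
opposite-injective {i = i} {j} eq = trans (sym (Fin.opposite-involutive i))
  (trans (cong opposite eq) (Fin.opposite-involutive j))

fromRight : ∀ {l n} → l < n → Fin n
fromRight l<n = opposite (fromℕ< l<n)

toℕ-opposite-fromRight : ∀ {l n} (l<n : l < n) → toℕ (opposite (fromRight l<n)) ≡ l
toℕ-opposite-fromRight l<n =
  trans (cong toℕ (Fin.opposite-involutive (fromℕ< l<n))) (Fin.toℕ-fromℕ< l<n)

columnsᵛ : (ℕ → ℕ) → ∀ n → Vec ℕ n
columnsᵛ f zero    = Vec.[]
columnsᵛ f (suc n) = f n Vec.∷ columnsᵛ f n

toList-columnsᵛ : ∀ f n → toList (columnsᵛ f n) ≡ applyDownFrom f n
toList-columnsᵛ f zero    = refl
toList-columnsᵛ f (suc n) = cong (f n ∷_) (toList-columnsᵛ f n)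

lookup-columnsᵛ : ∀ f {n} (i : Fin n) → lookup (columnsᵛ f n) i ≡ f (toℕ (opposite i))
lookup-columnsᵛ f {n} i = trans (by-∸ n i) (cong f (sym (Fin.opposite-prop i)))
  where
  by-∸ : ∀ n (i : Fin n) → lookup (columnsᵛ f n) i ≡ f (n ∸ suc (toℕ i))
  by-∸ (suc n) Fin.zero    = refl
  by-∸ (suc n) (Fin.suc i) = by-∸ n i

writtenAs-columnsᵛ : ∀ B {n} → width B ≤ n → WrittenAs B (columnsᵛ (height B) n)
writtenAs-columnsᵛ B {n} w≤n = n ∸ width B , (begin
  toList (columnsᵛ (height B) n)                     ≡⟨ toList-columnsᵛ (height B) n ⟩
  applyDownFrom (height B) n                         ≡⟨ cong (applyDownFrom (height B)) (m+[n∸m]≡n w≤n) ⟨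
  applyDownFrom (height B) (width B + (n ∸ width B)) ≡⟨ pad-columns B (n ∸ width B) ⟨
  pad (n ∸ width B) (columns B)                      ∎)
  where open ≡-Reasoning

writtenAs⇒width≤ : ∀ B {n} {v : Vec ℕ n} → WrittenAs B v → width B ≤ n
writtenAs⇒width≤ B {n} {v} (m , eq) = subst (width B ≤_)
  (trans (sym (length-++ (replicate m 0))) (trans (cong length (sym eq)) (length-toList v)))
  (m≤n+m (width B) (length (replicate m 0)))

-- `DifferInTwoColumns` with columns indexed from the right, where no common number of columns has
-- to be chosen.
Differ : Rel (ℕ → ℕ) 0ℓ
Differ f g = ∃₂ λ i j → ∃ λ k → i ≢ j × 0 < k × f i ≡ g i + k × g j ≡ f j + k ×
  (∀ l → l ≢ i → l ≢ j → f l ≡ g l)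

boardAdjacent⇒differ : ∀ A B → BoardAdjacent A B → Differ (height A) (height B)
boardAdjacent⇒differ A B (n , v , w , Av , Bw , i , j , k , i≢j , 0<k , vi , wj , rest) =
  toℕ (opposite i) , toℕ (opposite j) , k , i≢j ∘ opposite-injective ∘ Fin.toℕ-injective , 0<k ,
  trans (sym (v≡ i)) (trans vi (cong (_+ k) (w≡ i))) ,
  trans (sym (w≡ j)) (trans wj (cong (_+ k) (v≡ j))) ,
  elsewhere
  where
  v≡ : ∀ l → lookup v l ≡ height A (toℕ (opposite l))
  v≡ l = trans (cong (λ u → lookup u l)
                 (writtenAs-unique {B = A} {v} Av (writtenAs-columnsᵛ A (writtenAs⇒width≤ A {v = v} Av))))
               (lookup-columnsᵛ (height A) l)

  w≡ : ∀ l → lookup w l ≡ height B (toℕ (opposite l))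
  w≡ l = trans (cong (λ u → lookup u l)
                 (writtenAs-unique {B = B} {w} Bw (writtenAs-columnsᵛ B (writtenAs⇒width≤ B {v = w} Bw))))
               (lookup-columnsᵛ (height B) l)

  elsewhere : ∀ l → l ≢ toℕ (opposite i) → l ≢ toℕ (opposite j) → height A l ≡ height B l
  elsewhere l l≢i l≢j with l <? n
  ... | no  l≮n = trans (height-beyond A (≤-trans (writtenAs⇒width≤ A {v = v} Av) (≮⇒≥ l≮n)))
                        (sym (height-beyond B (≤-trans (writtenAs⇒width≤ B {v = w} Bw) (≮⇒≥ l≮n))))
  ... | yes l<n = begin
    height A l                    ≡⟨ cong (height A) position ⟨
    height A (toℕ (opposite l′))  ≡⟨ v≡ l′ ⟨
    lookup v l′                   ≡⟨ rest l′ (λ { refl → l≢i (sym position) }) (λ { refl → l≢j (sym position) }) ⟩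
    lookup w l′                   ≡⟨ w≡ l′ ⟩
    height B (toℕ (opposite l′))  ≡⟨ cong (height B) position ⟩
    height B l                    ∎
    where
    open ≡-Reasoning
    l′ = fromRight l<n
    position = toℕ-opposite-fromRight l<n

differ⇒boardAdjacent : ∀ A B → Differ (height A) (height B) → BoardAdjacent A B
differ⇒boardAdjacent A B (i , j , k , i≢j , 0<k , fi , gj , rest) =
  n , columnsᵛ (height A) n , columnsᵛ (height B) n ,
  writtenAs-columnsᵛ A (m≤m+n (width A) (width B)) , writtenAs-columnsᵛ B (m≤n+m (width B) (width A)) ,
  fromRight i<n , fromRight j<n , k ,
  (λ eq → i≢j (trans (sym (toℕ-opposite-fromRight i<n))
    (trans (cong (toℕ ∘ opposite) eq) (toℕ-opposite-fromRight j<n)))) ,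
  0<k ,
  trans (lookup-column (height A) i<n) (trans fi (cong (_+ k) (sym (lookup-column (height B) i<n)))) ,
  trans (lookup-column (height B) j<n) (trans gj (cong (_+ k) (sym (lookup-column (height A) j<n)))) ,
  λ l l≢i l≢j → trans (lookup-columnsᵛ (height A) l)
    (trans (rest (toℕ (opposite l)) (l≢i ∘ column-unique i<n) (l≢j ∘ column-unique j<n))
           (sym (lookup-columnsᵛ (height B) l)))
  where
  -- A common number of columns. It covers `i` and `j`, because `A` is positive at `i` and `B` at
  -- `j`.
  n = width A + width B

  i<n : i < n
  i<n = m≤n⇒m≤n+o (width B) (height-positive⇒< A (subst (0 <_) (sym fi) (m≤n⇒m≤o+n (height B i) 0<k)))

  j<n : j < n
  j<n = m≤n⇒m≤o+n (width A) (height-positive⇒< B (subst (0 <_) (sym gj) (m≤n⇒m≤o+n (height A j) 0<k)))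

  lookup-column : ∀ f {l} (l<n : l < n) → lookup (columnsᵛ f n) (fromRight l<n) ≡ f l
  lookup-column f l<n = trans (lookup-columnsᵛ f (fromRight l<n)) (cong f (toℕ-opposite-fromRight l<n))

  column-unique : ∀ {l} (l<n : l < n) {c : Fin n} → toℕ (opposite c) ≡ l → c ≡ fromRight l<n
  column-unique l<n eq = opposite-injective (Fin.toℕ-injective (trans eq (sym (toℕ-opposite-fromRight l<n))))

-- Exchanges of columns

rooks-zeros : ∀ bs m → rooks (bs ++ replicate m 0) ≗ rooks bs
rooks-zeros bs zero    k = cong (λ cs → rooks cs k) (++-identityʳ bs)
rooks-zeros bs (suc m) k = trans (cong (λ cs → rooks cs k) (sym (∷ʳ-++ bs 0 (replicate m 0))))
  (trans (rooks-zeros (bs ∷ʳ 0) m k) (rooks-∷ʳ-0 bs k))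

rooks-height : ∀ B {n} → width B ≤ n → ∀ k → rooks (applyUpTo (height B) n) k ≡ + rookNumber k B
rooks-height B {n} w≤n k = begin
  rooks (applyUpTo (height B) n) k
    ≡⟨ cong (λ m → rooks (applyUpTo (height B) m) k) (m+[n∸m]≡n w≤n) ⟨
  rooks (applyUpTo (height B) (width B + (n ∸ width B))) k
    ≡⟨ cong (λ bs → rooks bs k) (applyUpTo-height B (n ∸ width B)) ⟩
  rooks (reverse (columns B) ++ replicate (n ∸ width B) 0) k
    ≡⟨ rooks-zeros (reverse (columns B)) (n ∸ width B) k ⟩
  rooks (reverse (columns B)) k
    ≡⟨ rookNumber-rooks k B ⟨
  + rookNumber k B ∎
  where open ≡-Reasoning

realise : ∀ {B f n} → Decreasing f → (∀ {i} → n ≤ i → f i ≡ 0) →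
          (∀ k → rooks (applyUpTo f n) k ≡ + rookNumber k B) →
          Σ Board λ A → RookEquivalent A B × height A ≗ f
realise {B} {f} {n} dec f≡0 eq = A ,
  (λ k → ℤ.+-injective (trans (rookNumber-rooks k A) (trans (cong (λ bs → rooks bs k) reversed) (eq k)))) ,
  (λ i → trans (cong (λ bs → heightAt bs i) reversed) (heightAt-applyUpTo n f≡0 i))
  where
  A : Board
  A = board (applyDownFrom f n) (applyDownFrom⁺₂ ≤-totalOrder f n dec)
  reversed : reverse (columns A) ≡ applyUpTo f n
  reversed = reverse-applyDownFrom f n

falling-board : ∀ B → Σ Board λ A → RookEquivalent A B × ∀ i → height A i ↘ height A (suc i)
falling-board B = A , A~B , λ i → subst₂ _↘_ (sym (A≗f i)) (sym (A≗f (suc i))) (f↘ i)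
  where
  bs = straighten (reverse (columns B))
  f↘ = heightAt-falling (falling-straighten (reverse (columns B)))

  applyUpTo-bs : applyUpTo (heightAt bs) (length bs) ≡ bs
  applyUpTo-bs = trans (cong (applyUpTo (heightAt bs)) (sym (+-identityʳ (length bs))))
    (trans (applyUpTo-heightAt bs 0) (++-identityʳ bs))

  realised = realise {B} (λ i → ↘⇒≥ (f↘ i)) (heightAt-beyond bs) λ k →
    trans (cong (λ cs → rooks cs k) applyUpTo-bs)
      (trans (rooks-straighten (columns-decreasing B) k) (sym (rookNumber-rooks k B)))

  A   = proj₁ realised
  A~B = proj₁ (proj₂ realised)
  A≗f = proj₂ (proj₂ realised)

-- For a drop of 2 at `l` this exchanges the values `f l + l` and `f (suc l) + suc l`, which then
-- differ by 1. It is applied only there, so `pred` never meets 0.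
move : ℕ → (ℕ → ℕ) → (ℕ → ℕ)
move zero    f zero          = pred (f 0)
move zero    f (suc zero)    = suc (f 1)
move zero    f (suc (suc i)) = f (suc (suc i))
move (suc l) f zero          = f 0
move (suc l) f (suc i)       = move l (f ∘ suc) i

move-at : ∀ l f → move l f l ≡ pred (f l)
move-at zero    f = refl
move-at (suc l) f = move-at l (f ∘ suc)

move-at-suc : ∀ l f → move l f (suc l) ≡ suc (f (suc l))
move-at-suc zero    f = refl
move-at-suc (suc l) f = move-at-suc l (f ∘ suc)

move-elsewhere : ∀ l f {i} → i ≢ l → i ≢ suc l → move l f i ≡ f i
move-elsewhere zero    f {zero}        i≢l i≢l′ = contradiction refl i≢l
move-elsewhere zero    f {suc zero}    i≢l i≢l′ = contradiction refl i≢l′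
move-elsewhere zero    f {suc (suc i)} i≢l i≢l′ = refl
move-elsewhere (suc l) f {zero}        i≢l i≢l′ = refl
move-elsewhere (suc l) f {suc i}       i≢l i≢l′ = move-elsewhere l (f ∘ suc) (i≢l ∘ cong suc) (i≢l′ ∘ cong suc)

move-decreasing : ∀ l {f} → f l ≡ 2 + f (suc l) → Decreasing f → Decreasing (move l f)
move-decreasing zero    {f} gap dec zero          = ≤-reflexive (sym (cong pred gap))
move-decreasing zero    {f} gap dec (suc zero)    = m≤n⇒m≤1+n (dec 1)
move-decreasing zero    {f} gap dec (suc (suc i)) = dec (2 + i)
move-decreasing (suc l) {f} gap dec zero          = ≤-trans (move-head l) (dec 0)
  where
  move-head : ∀ l {g} → move l g 0 ≤ g 0
  move-head zero    {g} = pred[n]≤n {g 0}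
  move-head (suc l)     = ≤-refl
move-decreasing (suc l) {f} gap dec (suc i)       = move-decreasing l gap (dec ∘ suc) i

rooks-move : ∀ l {f n} → f l ≡ 2 + f (suc l) → suc l < n →
             rooks (applyUpTo (move l f) n) ≗ rooks (applyUpTo f n)
rooks-move zero {f} {suc (suc n)} gap l<n k = begin
  rooks (pred (f 0) ∷ suc (f 1) ∷ bs) k   ≡⟨ cong (λ b → rooks (pred b ∷ suc (f 1) ∷ bs) k) gap ⟩
  -- The exchange law with `a = f 1` and `b = suc (f 1)`: one side has two equal heights, the other
  -- a drop of 2.
  rooks (suc (f 1) ∷ suc (f 1) ∷ bs) k    ≡⟨ rooks-exchange (f 1) (suc (f 1)) bs k ⟩
  rooks (suc (suc (f 1)) ∷ f 1 ∷ bs) k    ≡⟨ cong (λ b → rooks (b ∷ f 1 ∷ bs) k) gap ⟨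
  rooks (f 0 ∷ f 1 ∷ bs) k                ∎
  where
  open ≡-Reasoning
  bs = applyUpTo (f ∘ suc ∘ suc) n
rooks-move zero {n = suc zero} gap (s≤s ())
rooks-move (suc l) {f} {suc n} gap (s≤s l<n) = rooks-∷-cong (f 0) (rooks-move l gap l<n)

move-board : ∀ B l → height B l ≡ 2 + height B (suc l) →
             Σ Board λ A → RookEquivalent A B × height A ≗ move l (height B)
move-board B l gap = realise {B} (move-decreasing l gap (height-decreasing B)) beyond
  λ k → trans (rooks-move l gap (s≤s l<w) k) (rooks-height B (n≤1+n (width B)) k)
  where
  l<w : l < width B
  l<w = height-positive⇒< B (subst (0 <_) (sym gap) z<s)

  -- One column more than the width is needed, since `suc l` may be the first padding column.
  beyond : ∀ {i} → suc (width B) ≤ i → move l (height B) i ≡ 0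
  beyond w<i = trans (move-elsewhere l (height B)
      (≢-sym (<⇒≢ (<-trans l<w w<i))) (≢-sym (<⇒≢ (<-≤-trans (s≤s l<w) w<i))))
    (height-beyond B (<⇒≤ w<i))

-- Both sides consist of the other columns together with the squares of `f` and of `g` in column
-- `i`; this avoids subtraction.
sumOfSquares-update : ∀ {f g : ℕ → ℕ} s n {i} → i < n → (∀ l → l ≢ i → f l ≡ g l) →
  sumOfSquares s (applyUpTo f n) + (g i + (i + s)) * (g i + (i + s)) ≡
  sumOfSquares s (applyUpTo g n) + (f i + (i + s)) * (f i + (i + s))
sumOfSquares-update {f} {g} s (suc n) {zero} i<n eq =
  trans (cong (λ bs → (f 0 + s) * (f 0 + s) + sumOfSquares (suc s) bs + (g 0 + s) * (g 0 + s))
              (applyUpTo-cong (λ l → eq (suc l) λ ()) n))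
        (swap ((f 0 + s) * (f 0 + s)) (sumOfSquares (suc s) (applyUpTo (g ∘ suc) n)) ((g 0 + s) * (g 0 + s)))
  where
  swap : ∀ x y z → x + y + z ≡ z + y + x
  swap = solve-∀
sumOfSquares-update {f} {g} s (suc n) {suc i} (s≤s i<n) eq = begin
  (f 0 + s) * (f 0 + s) + F + square (g (suc i) + suc (i + s))
    ≡⟨ +-assoc ((f 0 + s) * (f 0 + s)) F _ ⟩
  (f 0 + s) * (f 0 + s) + (F + square (g (suc i) + suc (i + s)))
    ≡⟨ cong₂ (λ x y → (x + s) * (x + s) + (F + square (g (suc i) + y))) (eq 0 λ ()) (sym (+-suc i s)) ⟩
  (g 0 + s) * (g 0 + s) + (F + square (g (suc i) + (i + suc s)))
    ≡⟨ cong (λ x → square (g 0 + s) + x)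
         (sumOfSquares-update (suc s) n i<n λ l l≢i → eq (suc l) (l≢i ∘ suc-injective)) ⟩
  (g 0 + s) * (g 0 + s) + (G + square (f (suc i) + (i + suc s)))
    ≡⟨ cong (λ y → (g 0 + s) * (g 0 + s) + (G + square (f (suc i) + y))) (+-suc i s) ⟩
  (g 0 + s) * (g 0 + s) + (G + square (f (suc i) + suc (i + s)))
    ≡⟨ +-assoc ((g 0 + s) * (g 0 + s)) G _ ⟨
  (g 0 + s) * (g 0 + s) + G + square (f (suc i) + suc (i + s)) ∎
  where
  open ≡-Reasoning
  square : ℕ → ℕ
  square x = x * x
  F = sumOfSquares (suc s) (applyUpTo (f ∘ suc) n)
  G = sumOfSquares (suc s) (applyUpTo (g ∘ suc) n)

-- The columns are ordered by index here, not by the direction in which cells pass as in `Differ`: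
-- either of them may gain.
record Transposed (f g : ℕ → ℕ) : Set where
  constructor transposed
  field
    {i j}     : ℕ
    i<j       : i < j
    fi≢gi     : f i ≢ g i
    gi≡fj     : g i + i ≡ f j + j
    gj≡fi     : g j + j ≡ f i + i
    elsewhere : ∀ l → l ≢ i → l ≢ j → g l ≡ f l

-- Expansion leaves `2 k x = 2 k y`, and `k` is positive.
squares-balanced⇒≡ : ∀ x y {k} → 0 < k → (x + k) * (x + k) + y * y ≡ x * x + (y + k) * (y + k) → x ≡ y
squares-balanced⇒≡ x y {k@(suc _)} 0<k eq =
  *-cancelˡ-≡ x y (2 * k) (+-cancelˡ-≡ (x * x + y * y + k * k) _ _
    (trans (sym (expandˡ x y k)) (trans eq (expandʳ x y k))))
  where
  expandˡ : ∀ x y k → (x + k) * (x + k) + y * y ≡ x * x + y * y + k * k + 2 * k * x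
  expandˡ = solve-∀
  expandʳ : ∀ x y k → x * x + (y + k) * (y + k) ≡ x * x + y * y + k * k + 2 * k * y
  expandʳ = solve-∀

sumOfSquares-differ : ∀ {f g : ℕ → ℕ} n {i j} → i < n → j < n → i ≢ j → (∀ l → l ≢ i → l ≢ j → f l ≡ g l) →
  sumOfSquares 0 (applyUpTo f n) ≡ sumOfSquares 0 (applyUpTo g n) →
  (f i + i) * (f i + i) + (f j + j) * (f j + j) ≡ (g i + i) * (g i + i) + (g j + j) * (g j + j)
sumOfSquares-differ {f} {g} n {i} {j} i<n j<n i≢j rest same =
  +-cancelʳ-≡ (F + H) _ _ (begin
    a + b + (F + H)      ≡⟨ regroup a b F H ⟩
    (H + a) + (F + b)    ≡⟨ cong₂ _+_ (sym step-i) (cong (_+ b) same) ⟩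
    (F + c) + (G + b)    ≡⟨ cong (λ x → F + c + x) (sym step-j) ⟩
    (F + c) + (H + d)    ≡⟨ regroup′ F c H d ⟩
    c + d + (F + H)      ∎)
  where
  open ≡-Reasoning
  -- An intermediate sequence: it can differ from `f` only in column `i` and from `g` only in column
  -- `j`, so two single updates suffice.
  h : ℕ → ℕ
  h l with l ≟ i
  ... | yes _ = g l
  ... | no  _ = f l

  h-i : h i ≡ g i
  h-i with i ≟ i
  ... | yes _  = refl
  ... | no i≢i = contradiction refl i≢i

  h-elsewhere : ∀ l → l ≢ i → h l ≡ f l
  h-elsewhere l l≢i with l ≟ i
  ... | yes l≡i = contradiction l≡i l≢i
  ... | no  _   = refl

  h-g : ∀ l → l ≢ j → h l ≡ g l
  h-g l l≢j with l ≟ i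
  ... | yes _  = refl
  ... | no l≢i = rest l l≢i l≢j

  a = (f i + i) * (f i + i)
  b = (f j + j) * (f j + j)
  c = (g i + i) * (g i + i)
  d = (g j + j) * (g j + j)
  F = sumOfSquares 0 (applyUpTo f n)
  G = sumOfSquares 0 (applyUpTo g n)
  H = sumOfSquares 0 (applyUpTo h n)

  update : ∀ (f g : ℕ → ℕ) {i} → i < n → (∀ l → l ≢ i → f l ≡ g l) →
    sumOfSquares 0 (applyUpTo f n) + (g i + i) * (g i + i) ≡ sumOfSquares 0 (applyUpTo g n) + (f i + i) * (f i + i)
  update f g {i} i<n eq = subst
    (λ m → sumOfSquares 0 (applyUpTo f n) + (g i + m) * (g i + m) ≡ sumOfSquares 0 (applyUpTo g n) + (f i + m) * (f i + m))
    (+-identityʳ i) (sumOfSquares-update 0 n i<n eq)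

  step-i : F + c ≡ H + a
  step-i = trans (cong (λ x → F + (x + i) * (x + i)) (sym h-i)) (update f h i<n λ l l≢i → sym (h-elsewhere l l≢i))

  step-j : H + d ≡ G + b
  step-j = trans (update h g j<n h-g) (cong (λ x → G + (x + j) * (x + j)) (h-elsewhere j (≢-sym i≢j)))

  regroup : ∀ a b F H → a + b + (F + H) ≡ (H + a) + (F + b)
  regroup = solve-∀
  regroup′ : ∀ F c H d → (F + c) + (H + d) ≡ c + d + (F + H)
  regroup′ = solve-∀

-- The sums of squares agree and only columns `i` and `j` change. With `x = g i + i` and
-- `y = f j + j` this reads `(x + k)² + y² = x² + (y + k)²`, which forces `x = y`.
differ⇒transposed : ∀ {A B} → RookEquivalent A B → Differ (height A) (height B) →
                    Transposed (height A) (height B)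
differ⇒transposed {A} {B} A~B (i , j , k , i≢j , 0<k , fi , gj , rest) = ordered (<-cmp i j)
  where
  f = height A
  g = height B
  n = width A + width B

  same : sumOfSquares 0 (applyUpTo f n) ≡ sumOfSquares 0 (applyUpTo g n)
  same = sumOfSquares-unique {applyUpTo f n} {applyUpTo g n}
    (trans (length-applyUpTo f n) (sym (length-applyUpTo g n)))
    λ k → trans (rooks-height A (m≤m+n (width A) (width B)) k)
      (trans (cong +_ (A~B k)) (sym (rooks-height B (m≤n+m (width B) (width A)) k)))

  i<n : i < n
  i<n = m≤n⇒m≤n+o (width B) (height-positive⇒< A (subst (0 <_) (sym fi) (m≤n⇒m≤o+n (g i) 0<k)))

  j<n : j < n
  j<n = m≤n⇒m≤o+n (width A) (height-positive⇒< B (subst (0 <_) (sym gj) (m≤n⇒m≤o+n (f j) 0<k)))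

  +-right : ∀ x k y → x + k + y ≡ x + y + k
  +-right = solve-∀

  fi+i : f i + i ≡ g i + i + k
  fi+i = trans (cong (_+ i) fi) (+-right (g i) k i)

  gj+j : g j + j ≡ f j + j + k
  gj+j = trans (cong (_+ j) gj) (+-right (f j) k j)

  gi≡fj : g i + i ≡ f j + j
  gi≡fj = squares-balanced⇒≡ (g i + i) (f j + j) 0<k (begin
    (g i + i + k) * (g i + i + k) + (f j + j) * (f j + j)  ≡⟨ cong (λ x → x * x + (f j + j) * (f j + j)) fi+i ⟨
    (f i + i) * (f i + i) + (f j + j) * (f j + j)          ≡⟨ sumOfSquares-differ n i<n j<n i≢j rest same ⟩
    (g i + i) * (g i + i) + (g j + j) * (g j + j)          ≡⟨ cong (λ x → (g i + i) * (g i + i) + x * x) gj+j ⟩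
    (g i + i) * (g i + i) + (f j + j + k) * (f j + j + k)  ∎)
    where open ≡-Reasoning

  gj≡fi : g j + j ≡ f i + i
  gj≡fi = trans gj+j (trans (cong (_+ k) (sym gi≡fj)) (sym fi+i))

  ordered : Tri (i < j) (i ≡ j) (j < i) → Transposed f g
  ordered (tri< i<j _ _) = transposed i<j (λ eq → <⇒≢ (m<m+n (g i) 0<k) (trans (sym eq) fi)) gi≡fj gj≡fi
    λ l l≢i l≢j → sym (rest l l≢i l≢j)
  ordered (tri≈ _ i≡j _) = contradiction i≡j i≢j
  ordered (tri> _ _ j<i) = transposed j<i (λ eq → <⇒≢ (m<m+n (f j) 0<k) (trans eq gj)) gj≡fi gi≡fj
    λ l l≢j l≢i → sym (rest l l≢i l≢j)

-- Edges between boards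

-- Pigeonhole: three distinct columns cannot all be among the two that change.
differ⇒agree : ∀ {f g a b c} → Differ f g → a ≢ b → b ≢ c → a ≢ c → f a ≡ g a ⊎ f b ≡ g b ⊎ f c ≡ g c
differ⇒agree {f} {g} {a} {b} {c} (i , j , k , _ , _ , _ , _ , rest) a≢b b≢c a≢c with hit a | hit b | hit c
  where
  hit : ∀ l → f l ≡ g l ⊎ l ≡ i ⊎ l ≡ j
  hit l with l ≟ i | l ≟ j
  ... | yes l≡i | _       = inj₂ (inj₁ l≡i)
  ... | no _    | yes l≡j = inj₂ (inj₂ l≡j)
  ... | no l≢i  | no l≢j  = inj₁ (rest l l≢i l≢j)
... | inj₁ eq          | _                | _                = inj₁ eq
... | inj₂ _           | inj₁ eq          | _                = inj₂ (inj₁ eq)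
... | inj₂ _           | inj₂ _           | inj₁ eq          = inj₂ (inj₂ eq)
... | inj₂ (inj₁ refl) | inj₂ (inj₁ refl) | inj₂ _           = contradiction refl a≢b
... | inj₂ (inj₂ refl) | inj₂ (inj₂ refl) | inj₂ _           = contradiction refl a≢b
... | inj₂ (inj₁ refl) | inj₂ (inj₂ refl) | inj₂ (inj₁ refl) = contradiction refl a≢c
... | inj₂ (inj₁ refl) | inj₂ (inj₂ refl) | inj₂ (inj₂ refl) = contradiction refl b≢c
... | inj₂ (inj₂ refl) | inj₂ (inj₁ refl) | inj₂ (inj₁ refl) = contradiction refl b≢c
... | inj₂ (inj₂ refl) | inj₂ (inj₁ refl) | inj₂ (inj₂ refl) = contradiction refl a≢c

-- A move as a relation, since a neighbour obtained from the isomorphism is known only through its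
-- heights.
record Moved (l : ℕ) (f g : ℕ → ℕ) : Set where
  constructor moved
  field
    gap       : f l ≡ 2 + f (suc l)
    at        : g l ≡ 1 + f (suc l)
    at-suc    : g (suc l) ≡ 1 + f (suc l)
    elsewhere : ∀ {i} → i ≢ l → i ≢ suc l → g i ≡ f i

moved⇒differ : ∀ {l f g} → Moved l f g → Differ f g
moved⇒differ {l} {f} m = l , suc l , 1 , 1+n≢n ∘ sym , z<s ,
  trans gap (trans (cong suc (sym at)) (+-comm 1 _)) , trans at-suc (+-comm 1 _) ,
  λ i i≢l i≢l′ → sym (elsewhere i≢l i≢l′)
  where open Moved m

moved-unique : ∀ {l f g h} → Moved l f g → Moved l f h → g ≗ h
moved-unique {l} m m′ i with i ≟ l | i ≟ suc l
... | yes refl | _        = trans (Moved.at m) (sym (Moved.at m′))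
... | no _     | yes refl = trans (Moved.at-suc m) (sym (Moved.at-suc m′))
... | no i≢l   | no i≢l′  = trans (Moved.elsewhere m i≢l i≢l′) (sym (Moved.elsewhere m′ i≢l i≢l′))

Drop : (ℕ → ℕ) → ℕ → Set
Drop f l = f l ≡ 1 + f (suc l) ⊎ f l ≡ 2 + f (suc l)

-- The condition that K₃,₃ imposes on the boards of the class, stated on heights alone;
-- `neighbour-moved` uses nothing else about the graph.
Steady : (ℕ → ℕ) → Set
Steady f = ∀ l → Drop f l → Drop f (suc l) → f l ≡ 1 + f (1 + l) × f (1 + l) ≡ 1 + f (2 + l)

drop-bounded : ∀ {f : ℕ → ℕ} {l} → f (suc l) < f l → f l ≤ 2 + f (suc l) → Drop f l
drop-bounded {f} {l} lt le with m≤n⇒m<n∨m≡n le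
... | inj₁ lt′ = inj₁ (≤-antisym (≤-pred lt′) lt)
... | inj₂ eq  = inj₂ eq

-- If the exchanged columns are adjacent, monotonicity of `g` bounds the drop of `f` by 2, and a
-- drop of 1 would leave `f i` fixed. Otherwise the unchanged columns between them force every drop
-- of `f` in the range to be 1 or 2. There are at least two, so `Steady` makes them all 1; then
-- `f l + l` is constant and nothing is exchanged.
neighbour-moved : ∀ {f g} → (∀ i → f i ↘ f (suc i)) → Steady f → Decreasing g → Transposed f g →
                  ∃ λ l → Moved l f g
neighbour-moved {f} {g} fall steady dec (transposed {i} {suc j} (s≤s i≤j) fi≢gi gi≡fj gj≡fi elsewhere) =
  i , by-distance (m≤n⇒m<n∨m≡n i≤j)
  where
  f-step : ∀ l → f (suc l) ≤ f l
  f-step l = ↘⇒≥ (fall l)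

  u : ℕ → ℕ
  u l = f l + l

  u-distinct : u (suc j) ≢ u i
  u-distinct eq = fi≢gi (+-cancelʳ-≡ i _ _ (sym (trans gi≡fj eq)))

  -- This makes the descent strict through column `j`. Were `f j` zero with `i = j`, the value `i`
  -- would have to equal `g (suc i) + suc i`; with `i < j`, both `f` and `g` would vanish at
  -- `suc j`, against `u-distinct`.
  positive : 0 < f j
  positive = n≢0⇒n>0 λ fj≡0 → case-zero fj≡0 (m≤n⇒m<n∨m≡n i≤j)
    where
    case-zero : f j ≡ 0 → i < j ⊎ i ≡ j → ⊥
    case-zero fj≡0 (inj₂ refl) = m+1+n≢n (g (suc i)) (trans gj≡fi (cong (_+ i) fj≡0))
    case-zero fj≡0 (inj₁ i<j) = u-distinct (trans
      (cong (_+ suc j) (n≤0⇒n≡0 (≤-trans (f-step j) (≤-reflexive fj≡0))))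
      (trans (cong (_+ suc j) (sym gsj≡0)) gj≡fi))
      where
      gsj≡0 : g (suc j) ≡ 0
      gsj≡0 = n≤0⇒n≡0 (≤-trans (dec j) (≤-reflexive (trans (elsewhere j (≢-sym (<⇒≢ i<j)) (1+n≢n ∘ sym)) fj≡0)))

  f-antitone : ∀ {a b} → a ≤′ b → f b ≤ f a
  f-antitone ≤′-refl       = ≤-refl
  f-antitone (≤′-step a≤b) = ≤-trans (f-step _) (f-antitone a≤b)

  strict : ∀ l → l ≤ j → f (suc l) < f l
  strict l l≤j with fall l
  ... | inj₁ lt = lt
  ... | inj₂ eq = subst (_< f l) (sym eq) (<-≤-trans positive (f-antitone (≤⇒≤′ l≤j)))

  u-step : ∀ l → l ≤ j → u (suc l) ≤ u l
  u-step l l≤j = subst (_≤ u l) (sym (+-suc (f (suc l)) l)) (+-monoˡ-≤ l (strict l l≤j))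

  u-antitone : ∀ {a b} → a ≤′ b → b ≤ suc j → u b ≤ u a
  u-antitone ≤′-refl       _     = ≤-refl
  u-antitone (≤′-step a≤b) b<j = ≤-trans (u-step _ (≤-pred b<j)) (u-antitone a≤b (<⇒≤ b<j))

  by-distance : i < j ⊎ i ≡ j → Moved i f g
  by-distance (inj₂ refl) = moved fi≡ gi≡ gj≡ (λ {l} → elsewhere l)
    where
    gi≡ : g i ≡ 1 + f (suc i)
    gi≡ = +-cancelʳ-≡ i _ _ (trans gi≡fj (+-suc (f (suc i)) i))

    fi≡1+gj : f i ≡ 1 + g (suc i)
    fi≡1+gj = +-cancelʳ-≡ i _ _ (trans (sym gj≡fi) (+-suc (g (suc i)) i))

    fi≡ : f i ≡ 2 + f (suc i)
    fi≡ with drop-bounded {f} (strict i ≤-refl)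
               (subst₂ _≤_ (sym fi≡1+gj) (cong suc gi≡) (s≤s (dec i)))
    ... | inj₁ eq = contradiction (trans eq (sym gi≡)) fi≢gi
    ... | inj₂ eq = eq

    gj≡ : g (suc i) ≡ 1 + f (suc i)
    gj≡ = suc-injective (trans (sym fi≡1+gj) fi≡)
  by-distance (inj₁ i<j) = contradiction (constant (suc j) (m≤n⇒m≤1+n i≤j) ≤-refl) u-distinct
    where
    -- Column `suc i` is unchanged, so `g (suc i) ≤ g i` compares two values of `u`; in `end` the
    -- unchanged column `j` does the same at the other side.
    start : u (suc i) ≤ suc (u (suc j))
    start = begin
      f (suc i) + suc i  ≡⟨ cong (_+ suc i) (elsewhere (suc i) 1+n≢n (<⇒≢ (s≤s i<j))) ⟨
      g (suc i) + suc i  ≤⟨ +-monoˡ-≤ (suc i) (dec i) ⟩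
      g i + suc i        ≡⟨ +-suc (g i) i ⟩
      suc (g i + i)      ≡⟨ cong suc gi≡fj ⟩
      suc (u (suc j))    ∎
      where open ≤-Reasoning

    end : u i ≤ suc (u j)
    end = begin
      u i                ≡⟨ gj≡fi ⟨
      g (suc j) + suc j  ≤⟨ +-monoˡ-≤ (suc j) (dec j) ⟩
      g j + suc j        ≡⟨ cong (_+ suc j) (elsewhere j (≢-sym (<⇒≢ i<j)) (1+n≢n ∘ sym)) ⟩
      f j + suc j        ≡⟨ +-suc (f j) j ⟩
      suc (u j)          ∎
      where open ≤-Reasoning

    -- For `l > i` both values lie between `u (suc j)` and `u (suc i)`, which `start` keeps within
    -- 1. For `l = i` the bound is `end`, since `u j ≤ u (suc i)`.
    u-drop : ∀ {l} → i ≤ l → l ≤ j → u l ≤ suc (u (suc l))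
    u-drop i≤l l≤j with m≤n⇒m<n∨m≡n i≤l
    ... | inj₁ i<l  = ≤-trans (u-antitone (≤⇒≤′ i<l) (m≤n⇒m≤1+n l≤j))
                        (≤-trans start (s≤s (u-antitone (≤⇒≤′ (s≤s l≤j)) ≤-refl)))
    ... | inj₂ refl = ≤-trans end (s≤s (u-antitone (≤⇒≤′ i<j) (n≤1+n j)))

    drop : ∀ l → i ≤ l → l ≤ j → Drop f l
    drop l i≤l l≤j = drop-bounded {f} (strict l l≤j)
      (+-cancelʳ-≤ l _ _ (≤-trans (u-drop i≤l l≤j) (s≤s (≤-reflexive (+-suc (f (suc l)) l)))))

    -- `Steady` needs a second drop next to `l`: the following one, except at `l = j`, where the
    -- preceding one is taken.
    drop-1 : ∀ l → i ≤ l → l ≤ j → f l ≡ 1 + f (suc l)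
    drop-1 l i≤l l≤j with m≤n⇒m<n∨m≡n l≤j
    drop-1 l       i≤l l≤j | inj₁ l<j  = proj₁ (steady l (drop l i≤l l≤j) (drop (suc l) (m≤n⇒m≤1+n i≤l) l<j))
    drop-1 zero    i≤l l≤j | inj₂ refl = contradiction i<j λ ()
    drop-1 (suc l) i≤l l≤j | inj₂ refl =
      proj₂ (steady l (drop l (≤-pred i<j) (n≤1+n l)) (drop (suc l) i≤l ≤-refl))

    constant : ∀ l → i ≤ l → l ≤ suc j → u l ≡ u i
    constant l i≤l l≤j with m≤n⇒m<n∨m≡n i≤l
    constant l       i≤l l≤j       | inj₂ refl      = refl
    constant (suc l) i≤l (s≤s l≤j) | inj₁ (s≤s i≤l′) =
      trans (trans (+-suc (f (suc l)) l) (cong (_+ l) (sym (drop-1 l i≤l′ l≤j))))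
            (constant l i≤l′ (m≤n⇒m≤1+n l≤j))

-- The graph K₃,₃

-- At least two of the `A` hold and at least two of the `B`, so the two choices out of three indices
-- meet.
majority : ∀ {A₀ A₁ A₂ B₀ B₁ B₂ : Set} →
  A₀ ⊎ A₁ → A₁ ⊎ A₂ → A₀ ⊎ A₂ → B₀ ⊎ B₁ → B₁ ⊎ B₂ → B₀ ⊎ B₂ → A₀ × B₀ ⊎ A₁ × B₁ ⊎ A₂ × B₂
majority (inj₁ a₀) _         _         (inj₁ b₀) _         _         = inj₁ (a₀ , b₀)
majority (inj₁ a₀) _         _         (inj₂ _)  _         (inj₁ b₀) = inj₁ (a₀ , b₀)
majority (inj₁ _)  (inj₁ a₁) _         (inj₂ b₁) _         (inj₂ _)  = inj₂ (inj₁ (a₁ , b₁))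
majority (inj₁ _)  (inj₂ a₂) _         (inj₂ _)  _         (inj₂ b₂) = inj₂ (inj₂ (a₂ , b₂))
majority (inj₂ a₁) _         _         (inj₂ b₁) _         _         = inj₂ (inj₁ (a₁ , b₁))
majority (inj₂ a₁) _         _         (inj₁ _)  (inj₁ b₁) _         = inj₂ (inj₁ (a₁ , b₁))
majority (inj₂ _)  _         (inj₁ a₀) (inj₁ b₀) (inj₂ _)  _         = inj₁ (a₀ , b₀)
majority (inj₂ _)  _         (inj₂ a₂) (inj₁ _)  (inj₂ b₂) _         = inj₂ (inj₂ (a₂ , b₂))

-- Relative to `e = f (2 + l)`, columns `l`, `1 + l`, `2 + l` have heights (4, 2, 0) in `f`, (3, 3,
-- 0) in `p` and (4, 1, 1) in `q`. As `p` and `q` differ in all three, the exchange from `p` to `n`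
-- must stay inside them, and only the one restoring `f` gives decreasing heights.
no-second-neighbour : ∀ {l f p q n} → Moved l f p → Moved (suc l) f q → Decreasing n →
  Differ p n → Differ q n → Transposed p n → n ≗ f
no-second-neighbour {l} {f} {p} {q} {n} mp mq dec dp dq (transposed {i} {j} i<j pi≢ni ni≡pj nj≡pi rest) =
  within (inside pi≢ni) (inside pj≢nj)
  where
  module P = Moved mp
  module Q = Moved mq

  e : ℕ
  e = f (2 + l)

  l+1≢l : suc l ≢ l
  l+1≢l = 1+n≢n
  l+2≢l : suc (suc l) ≢ l
  l+2≢l = m+1+n≢n 1

  f₀ : f l ≡ 4 + e
  f₀ = trans P.gap (cong (suc ∘ suc) Q.gap)
  p₀ : p l ≡ 3 + e
  p₀ = trans P.at (cong suc Q.gap)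
  p₁ : p (suc l) ≡ 3 + e
  p₁ = trans P.at-suc (cong suc Q.gap)
  p₂ : p (2 + l) ≡ e
  p₂ = P.elsewhere l+2≢l 1+n≢n
  q₀ : q l ≡ 4 + e
  q₀ = trans (Q.elsewhere (≢-sym l+1≢l) (≢-sym l+2≢l)) f₀

  pj≢nj : p j ≢ n j
  pj≢nj eq = pi≢ni (+-cancelʳ-≡ i _ _ (trans (sym nj≡pi) (trans (cong (_+ j) (sym eq)) (sym ni≡pj))))

  agree-twice : ∀ {g h x} → Differ g h → g x ≢ h x → ∀ {a b} → x ≢ a → a ≢ b → x ≢ b → g a ≡ h a ⊎ g b ≡ h b
  agree-twice d x≢ x≢a a≢b x≢b with differ⇒agree d x≢a a≢b x≢b
  ... | inj₁ eq = contradiction eq x≢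
  ... | inj₂ eq = eq

  -- `p` and `q` agree at `x`, so `n` differs from both there, and from each in at most one of the
  -- three columns. By `majority` both agree with `n` in some column of the three, where `p` and `q`
  -- differ.
  outside : ∀ {x} → x ≢ l → x ≢ 1 + l → x ≢ 2 + l → p x ≢ n x → ⊥
  outside {x} x≢l x≢l+1 x≢l+2 px≢nx with majority
    (agree-twice dp px≢nx x≢l (≢-sym l+1≢l) x≢l+1)
    (agree-twice dp px≢nx x≢l+1 (≢-sym 1+n≢n) x≢l+2)
    (agree-twice dp px≢nx x≢l (≢-sym l+2≢l) x≢l+2)
    (agree-twice dq qx≢nx x≢l (≢-sym l+1≢l) x≢l+1)
    (agree-twice dq qx≢nx x≢l+1 (≢-sym 1+n≢n) x≢l+2)
    (agree-twice dq qx≢nx x≢l (≢-sym l+2≢l) x≢l+2)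
    where
    qx≢nx : q x ≢ n x
    qx≢nx eq = px≢nx (trans (trans (P.elsewhere x≢l x≢l+1) (sym (Q.elsewhere x≢l+1 x≢l+2))) eq)
  ... | inj₁ (p≡n , q≡n) = 1+n≢n (trans (trans (sym q₀) (trans q≡n (sym p≡n))) p₀)
  ... | inj₂ (inj₁ (p≡n , q≡n)) = m+1+n≢n 1 (trans (trans (sym p₁) (trans p≡n (sym q≡n))) Q.at)
  ... | inj₂ (inj₂ (p≡n , q≡n)) = 1+n≢n (trans (trans (sym Q.at-suc) (trans q≡n (sym p≡n))) p₂)

  Inside : ℕ → Set
  Inside x = x ≡ l ⊎ x ≡ 1 + l ⊎ x ≡ 2 + l

  inside : ∀ {x} → p x ≢ n x → Inside x
  inside {x} px≢nx with x ≟ l | x ≟ 1 + l | x ≟ 2 + l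
  ... | yes eq | _      | _      = inj₁ eq
  ... | no _   | yes eq | _      = inj₂ (inj₁ eq)
  ... | no _   | no _   | yes eq = inj₂ (inj₂ eq)
  ... | no ≢₀  | no ≢₁  | no ≢₂  = contradiction px≢nx (outside ≢₀ ≢₁ ≢₂)

  shift : ∀ k {x y} → x + l ≡ y + (k + l) → x ≡ k + y
  shift k {x} {y} eq = +-cancelʳ-≡ l _ _ (trans eq (trans (sym (+-assoc y k l)) (cong (_+ l) (+-comm y k))))

  -- The three exchanges turn (3, 3, 0) into (4, 2, 0), (2, 3, 1) and (3, 1, 2); the last two are
  -- not decreasing. The other clauses contradict `i < j`.
  within : Inside i → Inside j → n ≗ f
  within (inj₁ refl) (inj₂ (inj₁ refl)) x with x ≟ l | x ≟ 1 + l
  ... | yes refl | _        = trans (shift 1 ni≡pj) (trans (cong suc p₁) (sym f₀))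
  ... | no _     | yes refl = trans (suc-injective (trans (sym (shift 1 (sym nj≡pi))) p₀)) (sym Q.gap)
  ... | no x≢l   | no x≢l+1 = trans (rest x x≢l x≢l+1) (P.elsewhere x≢l x≢l+1)
  within (inj₁ refl) (inj₂ (inj₂ refl)) x = contradiction (dec l) (<⇒≱ (begin-strict
    n l        ≡⟨ trans (shift 2 ni≡pj) (cong (suc ∘ suc) p₂) ⟩
    2 + e      <⟨ n<1+n _ ⟩
    3 + e      ≡⟨ p₁ ⟨
    p (1 + l)  ≡⟨ rest (1 + l) 1+n≢n (≢-sym 1+n≢n) ⟨
    n (1 + l)  ∎))
    where open ≤-Reasoning
  within (inj₂ (inj₁ refl)) (inj₂ (inj₂ refl)) x = contradiction (dec (1 + l)) (<⇒≱ (begin-strict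
    n (1 + l)  ≡⟨ +-cancelʳ-≡ (1 + l) _ _ (trans ni≡pj (trans (cong (_+ (2 + l)) p₂) (+-suc e (1 + l)))) ⟩
    1 + e      <⟨ n<1+n _ ⟩
    2 + e      ≡⟨ suc-injective (trans (sym p₁)
                    (+-cancelʳ-≡ (1 + l) _ _ (trans (sym nj≡pi) (+-suc (n (2 + l)) (1 + l))))) ⟩
    n (2 + l)  ∎))
    where open ≤-Reasoning
  within (inj₁ refl) (inj₁ refl) = contradiction i<j (<-irrefl refl)
  within (inj₂ (inj₁ refl)) (inj₁ refl) = contradiction i<j (<-asym (n<1+n l))
  within (inj₂ (inj₁ refl)) (inj₂ (inj₁ refl)) = contradiction i<j (<-irrefl refl)
  within (inj₂ (inj₂ refl)) (inj₁ refl) = contradiction i<j (<-asym (m<n+m l z<s))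
  within (inj₂ (inj₂ refl)) (inj₂ (inj₁ refl)) = contradiction i<j (<-asym (n<1+n (1 + l)))
  within (inj₂ (inj₂ refl)) (inj₂ (inj₂ refl)) = contradiction i<j (<-irrefl refl)

Opposite : Rel (Fin 3 ⊎ Fin 3) 0ℓ
Opposite = OppositeSides

opposite-sym : ∀ a b → Opposite a b → Opposite b a
opposite-sym (inj₁ _) (inj₂ _) _ = tt
opposite-sym (inj₂ _) (inj₁ _) _ = tt

opposite-triangle-free : ∀ a b c → Opposite a b → Opposite b c → ¬ Opposite a c
opposite-triangle-free (inj₁ _) (inj₂ _) (inj₁ _) _ _ ()
opposite-triangle-free (inj₂ _) (inj₁ _) (inj₂ _) _ _ ()

opposite-path : ∀ a b c d → Opposite a b → Opposite b c → Opposite c d → Opposite a d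
opposite-path (inj₁ _) (inj₂ _) (inj₁ _) (inj₂ _) _ _ _ = tt
opposite-path (inj₂ _) (inj₁ _) (inj₂ _) (inj₁ _) _ _ _ = tt

across : Fin 3 ⊎ Fin 3 → Fin 3 → Fin 3 ⊎ Fin 3
across (inj₁ _) = inj₂
across (inj₂ _) = inj₁

across-opposite : ∀ a i → Opposite a (across a i)
across-opposite (inj₁ _) _ = tt
across-opposite (inj₂ _) _ = tt

across-injective : ∀ a {i j} → across a i ≡ across a j → i ≡ j
across-injective (inj₁ _) = inj₂-injective
across-injective (inj₂ _) = inj₁-injective

-- Any other vertex on the same side would serve, as all of them have the same neighbours.
twin : Fin 3 ⊎ Fin 3 → Fin 3 ⊎ Fin 3
twin = Sum.map other other
  where
  other : Fin 3 → Fin 3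
  other Fin.zero    = Fin.suc Fin.zero
  other (Fin.suc _) = Fin.zero

twin-≢ : ∀ a → twin a ≢ a
twin-≢ (inj₁ Fin.zero)    ()
twin-≢ (inj₁ (Fin.suc _)) ()
twin-≢ (inj₂ Fin.zero)    ()
twin-≢ (inj₂ (Fin.suc _)) ()

twin-opposite : ∀ a b → Opposite a b → Opposite b (twin a)
twin-opposite (inj₁ _) (inj₂ _) _ = tt
twin-opposite (inj₂ _) (inj₁ _) _ = tt

-- An isomorphism between K₃,₃ and a rook equivalence graph

module Contradiction (B : Board) (iso : completeBipartite 3 3 ≅ rookEquivalenceGraph B) where
  module G = SimpleGraph (rookEquivalenceGraph B)
  module Vertices = Setoid G.vertices
  open _≅_ iso using (bijection; to; from; adjacent⇔)
  open Inverse bijection using (strictlyInverseˡ; strictlyInverseʳ; from-cong)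

  heights : G.Vertex → ℕ → ℕ
  heights (A , _) = height A

  -- Adjacency carried to K₃,₃, where triangles and paths are settled by sides alone.
  Opposed : Rel G.Vertex 0ℓ
  Opposed u v = Opposite (from u) (from v)

  differ⇒opposed : ∀ u v → Differ (heights u) (heights v) → Opposed u v
  differ⇒opposed u v d = Equivalence.from (adjacent⇔ (from u) (from v))
    (G.adj-resp {u} {to (from u)} {v} {to (from v)}
      (Vertices.sym {to (from u)} {u} (strictlyInverseˡ u)) (Vertices.sym {to (from v)} {v} (strictlyInverseˡ v))
      (differ⇒boardAdjacent (proj₁ u) (proj₁ v) d))

  opposed⇒differ : ∀ u v → Opposed u v → Differ (heights u) (heights v)
  opposed⇒differ u v o = boardAdjacent⇒differ (proj₁ u) (proj₁ v)
    (G.adj-resp {to (from u)} {u} {to (from v)} {v} (strictlyInverseˡ u) (strictlyInverseˡ v)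
      (Equivalence.to (adjacent⇔ (from u) (from v)) o))

  opposed⇒transposed : ∀ u v → Opposed u v → Transposed (heights u) (heights v)
  opposed⇒transposed (A , A~B) (C , C~B) o =
    differ⇒transposed {A} {C} (λ k → trans (A~B k) (sym (C~B k))) (opposed⇒differ (A , A~B) (C , C~B) o)

  heights-injective : ∀ u v → heights u ≗ heights v → from u ≡ from v
  heights-injective u v eq = from-cong {u} {v} (height≗⇒≈ᵇ {proj₁ u} {proj₁ v} eq)

  move-vertex : ∀ u l → heights u l ≡ 2 + heights u (suc l) → Σ G.Vertex λ v → Moved l (heights u) (heights v)
  move-vertex (A , A~B) l gap with C , C~A , C≗ ← move-board A l gap =
    (C , λ k → trans (C~A k) (A~B k)) ,
    moved gap (trans (C≗ l) (trans (move-at l (height A)) (cong pred gap)))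
              (trans (C≗ (suc l)) (move-at-suc l (height A)))
              (λ i≢l i≢l′ → trans (C≗ _) (move-elsewhere l (height A) i≢l i≢l′))

  triangle-free : ∀ u v w → Differ (heights u) (heights v) → Differ (heights v) (heights w) →
                  ¬ Differ (heights u) (heights w)
  triangle-free u v w uv vw uw = opposite-triangle-free (from u) (from v) (from w)
    (differ⇒opposed u v uv) (differ⇒opposed v w vw) (differ⇒opposed u w uw)

  -- Moving twice, in the order that the drops (1 , 2) or (2 , 1) allow, transfers a
  -- single cell from column l to column 2 + l.
  steady : ∀ u → Steady (heights u)
  steady u l (inj₁ a) (inj₁ b) = a , b
  steady u l (inj₁ a) (inj₂ b)
    with v , mv ← move-vertex u (suc l) b
    with w , mw ← move-vertex v l (trans (Moved.elsewhere mv (≢-sym 1+n≢n) (≢-sym (m+1+n≢n 1)))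
                    (trans a (trans (cong suc b) (cong (suc ∘ suc) (sym (Moved.at mv))))))
    = contradiction transfer (triangle-free u v w (moved⇒differ mv) (moved⇒differ mw))
    where
    f = heights u
    h = heights w
    module V = Moved mv
    module W = Moved mw
    -- Relative to `f (2 + l)`, the three columns pass through (3, 2, 0), (3, 1, 1) and (2, 2, 1).
    transfer : Differ f h
    transfer = l , 2 + l , 1 , ≢-sym (m+1+n≢n 1) , z<s ,
      trans (trans a (cong suc (trans b (cong suc (sym V.at))))) (trans (cong suc (sym W.at)) (+-comm 1 _)) ,
      trans (W.elsewhere (m+1+n≢n 1) 1+n≢n) (trans V.at-suc (+-comm 1 _)) ,
      λ i i≢l i≢l+2 → same i i≢l i≢l+2 (i ≟ suc l)
      where
      same : ∀ i → i ≢ l → i ≢ 2 + l → Dec (i ≡ suc l) → f i ≡ h i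
      same i i≢l i≢l+2 (yes refl) = trans b (trans (cong suc (sym V.at)) (sym W.at-suc))
      same i i≢l i≢l+2 (no i≢l+1) = sym (trans (W.elsewhere i≢l i≢l+1) (V.elsewhere i≢l+1 i≢l+2))
  steady u l (inj₂ a) (inj₁ b)
    with v , mv ← move-vertex u l a
    with w , mw ← move-vertex v (suc l) (trans (Moved.at-suc mv)
                    (trans (cong suc b) (cong (suc ∘ suc) (sym (Moved.elsewhere mv (m+1+n≢n 1) 1+n≢n)))))
    = contradiction transfer (triangle-free u v w (moved⇒differ mv) (moved⇒differ mw))
    where
    f = heights u
    h = heights w
    module V = Moved mv
    module W = Moved mw
    v₂ : heights v (2 + l) ≡ f (2 + l)
    v₂ = V.elsewhere (m+1+n≢n 1) 1+n≢n
    -- Relative to `f (2 + l)`, the three columns pass through (3, 1, 0), (2, 2, 0) and (2, 1, 1).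
    transfer : Differ f h
    transfer = l , 2 + l , 1 , ≢-sym (m+1+n≢n 1) , z<s ,
      trans (trans a (cong suc (sym (trans (W.elsewhere (≢-sym 1+n≢n) (≢-sym (m+1+n≢n 1))) V.at)))) (+-comm 1 _) ,
      trans W.at-suc (trans (cong suc v₂) (+-comm 1 _)) ,
      λ i i≢l i≢l+2 → same i i≢l i≢l+2 (i ≟ suc l)
      where
      same : ∀ i → i ≢ l → i ≢ 2 + l → Dec (i ≡ suc l) → f i ≡ h i
      same i i≢l i≢l+2 (yes refl) = trans b (trans (cong suc (sym v₂)) (sym W.at))
      same i i≢l i≢l+2 (no i≢l+1) = sym (trans (W.elsewhere i≢l+1 i≢l+2) (V.elsewhere i≢l i≢l+1))
  -- `N` is a vertex other than `u` with the same neighbours, so it is adjacent to `v` and `w`;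
  -- `no-second-neighbour` then identifies it with `u`.
  steady u l (inj₂ a) (inj₂ b)
    with v , mv ← move-vertex u l a
    with w , mw ← move-vertex u (suc l) b
    = contradiction (trans (sym (strictlyInverseʳ (twin (from u)))) (heights-injective N u N≗u))
                    (twin-≢ (from u))
    where
    N : G.Vertex
    N = to (twin (from u))

    opposed-N : ∀ x → Differ (heights u) (heights x) → Opposed x N
    opposed-N x d = subst (Opposite (from x)) (sym (strictlyInverseʳ (twin (from u))))
      (twin-opposite (from u) (from x) (differ⇒opposed u x d))

    N≗u : heights N ≗ heights u
    N≗u = no-second-neighbour mv mw (height-decreasing (proj₁ N))
      (opposed⇒differ v N (opposed-N v (moved⇒differ mv)))
      (opposed⇒differ w N (opposed-N w (moved⇒differ mw)))
      (opposed⇒transposed v N (opposed-N v (moved⇒differ mv)))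

  -- Two drops of 2 in a row would violate `steady`. Hence moves at different columns of `u` touch
  -- disjoint pairs of columns.
  gaps-apart : ∀ u {a b} → heights u a ≡ 2 + heights u (suc a) → heights u b ≡ 2 + heights u (suc b) → b ≢ suc a
  gaps-apart u {a} ga gb refl = 1+n≢n (trans (sym ga) (proj₁ (steady u a (inj₂ ga) (inj₂ gb))))

  three-moves : ∀ u v₁ v₂ v₃ {a b c} → Moved a (heights u) (heights v₁) → Moved b (heights u) (heights v₂) →
                Moved c (heights u) (heights v₃) → a ≢ b → b ≢ c → a ≢ c → ⊥
  three-moves u v₁ v₂ v₃ {a} {b} {c} m₁ m₂ m₃ a≢b b≢c a≢c = impossible (differ⇒agree v₃-x a≢b b≢c a≢c)
    where
    module M₁ = Moved m₁
    module M₂ = Moved m₂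
    module M₃ = Moved m₃
    f = heights u

    apart : ∀ {i j} → f i ≡ 2 + f (suc i) → f j ≡ 2 + f (suc j) → j ≢ suc i
    apart = gaps-apart u

    v₁-b+1 : heights v₁ (suc b) ≡ f (suc b)
    v₁-b+1 = M₁.elsewhere (≢-sym (apart M₂.gap M₁.gap)) (≢-sym a≢b ∘ suc-injective)

    -- The move at `b` is still available after the one at `a`, since columns `b` and `suc b` are
    -- unchanged.
    further : Σ G.Vertex λ x → Moved b (heights v₁) (heights x)
    further = move-vertex v₁ b (trans (M₁.elsewhere (≢-sym a≢b) (apart M₁.gap M₂.gap))
                                      (trans M₂.gap (cong (suc ∘ suc) (sym v₁-b+1))))
    x = proj₁ further
    module X = Moved (proj₂ further)

    -- `v₃`, `u`, `v₁`, `x` is a path of length 3, so its ends are on opposite sides.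
    v₃-x : Differ (heights v₃) (heights x)
    v₃-x = opposed⇒differ v₃ x (opposite-path (from v₃) (from u) (from v₁) (from x)
      (opposite-sym (from u) (from v₃) (differ⇒opposed u v₃ (moved⇒differ m₃)))
      (differ⇒opposed u v₁ (moved⇒differ m₁))
      (differ⇒opposed v₁ x (moved⇒differ (proj₂ further))))

    x-a : heights x a ≡ 1 + f (suc a)
    x-a = trans (X.elsewhere a≢b (apart M₂.gap M₁.gap)) M₁.at
    x-b : heights x b ≡ 1 + f (suc b)
    x-b = trans X.at (cong suc v₁-b+1)
    x-c : heights x c ≡ 2 + f (suc c)
    x-c = trans (X.elsewhere (≢-sym b≢c) (apart M₂.gap M₃.gap))
            (trans (M₁.elsewhere (≢-sym a≢c) (apart M₁.gap M₃.gap)) M₃.gap)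
    v₃-a : heights v₃ a ≡ 2 + f (suc a)
    v₃-a = trans (M₃.elsewhere a≢c (apart M₃.gap M₁.gap)) M₁.gap
    v₃-b : heights v₃ b ≡ 2 + f (suc b)
    v₃-b = trans (M₃.elsewhere b≢c (apart M₃.gap M₂.gap)) M₂.gap

    -- Compared with `u`, only `x` has lost a cell at `a` and at `b`, and only `v₃` at `c`.
    impossible : ¬ (heights v₃ a ≡ heights x a ⊎ heights v₃ b ≡ heights x b ⊎ heights v₃ c ≡ heights x c)
    impossible (inj₁ eq)        = 1+n≢n (trans (sym v₃-a) (trans eq x-a))
    impossible (inj₂ (inj₁ eq)) = 1+n≢n (trans (sym v₃-b) (trans eq x-b))
    impossible (inj₂ (inj₂ eq)) = 1+n≢n (trans (sym x-c) (trans (sym eq) M₃.at))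

  absurd : ⊥
  absurd with A , A~B , fall ← falling-board B =
    three-moves u (v Fin.zero) (v (Fin.suc Fin.zero)) (v (Fin.suc (Fin.suc Fin.zero)))
      (proj₂ (m _)) (proj₂ (m _)) (proj₂ (m _))
      (distinct λ ()) (distinct λ ()) (distinct λ ())
    where
    u : G.Vertex
    u = A , A~B

    v : Fin 3 → G.Vertex
    v i = to (across (from u) i)

    from-v : ∀ i → from (v i) ≡ across (from u) i
    from-v i = strictlyInverseʳ (across (from u) i)

    m : ∀ i → ∃ λ l → Moved l (heights u) (heights (v i))
    m i = neighbour-moved fall (steady u) (height-decreasing (proj₁ (v i)))
      (opposed⇒transposed u (v i) (subst (Opposite (from u)) (sym (from-v i)) (across-opposite (from u) i)))

    -- The column of a move determines the resulting heights, so neighbours moved at the same column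
    -- would be the same vertex.
    distinct : ∀ {i j} → i ≢ j → proj₁ (m i) ≢ proj₁ (m j)
    distinct {i} {j} i≢j eq = i≢j (across-injective (from u) (trans (sym (from-v i))
      (trans (heights-injective (v i) (v j)
               (moved-unique (proj₂ (m i))
                 (subst (λ l → Moved l (heights u) (heights (v j))) (sym eq) (proj₂ (m j)))))
             (from-v j))))

theorem13 : (B : Board) → ¬ (completeBipartite 3 3 ≅ rookEquivalenceGraph B)
theorem13 B iso = Contradiction.absurd B iso
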